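{- Let $s,t\ge 1$ be coprime integers. Then $$\frac{\sum_{\lambda\in \mathcal{C}_s\cap \mathcal{C}_t} |\lambda|}{\sum_{\lambda\in \mathcal{C}_s\cap \mathcal{C}_t} 1} = \frac{1}{24}(s-1)(t-1)(s+t+1),$$ where the (finite) sums run over all partitions that are simultaneously $s$-cores and $t$-cores.
   Context: A partition is an infinite weakly decreasing sequence $\lambda=(\lambda_1,\lambda_2,\ldots)$ of nonnegative integers with finite size $|\lambda|=\lambda_1+\lambda_2+\cdots$. Its Young diagram is $[\lambda]=\{(r,c)\in\mathbb{Z}_{>0}^2 : c\le\lambda_r\}$, and its conjugate $\overline{\lambda}$ is defined by $\overline{\lambda}_r=\#\{c\in\mathbb{Z}_{>0}: r\le\lambda_c\}$. The hook length at $(r,c)\in[\lambda]$ is $1+(\lambda_r-r)+(\overline{\lambda}_c-c)$ (with the roles of row index $r$ and column index $c$ as in the usual hook length: $1+(\lambda_r-c)+(\overline{\lambda}_c-r)$, which is the same number). For $s\ge1$, a partition is an $s$-core if it has no hook of length $s$; $\mathcal{C}_s$ denotes the set of $s$-cores. For coprime $s,t\ge 1$ the set $\mathcal{C}_s\cap\mathcal{C}_t$ is finite. -}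

module Defs where

open import Data.List using (List; _∷_; length; map; filter; applyUpTo)
open import Data.List.Relation.Unary.All using (All)
import Data.List.Membership.Setoid as Membership
import Data.List.Relation.Unary.Unique.Setoid as Uniqueness
open import Data.Nat using (ℕ; suc; _+_; _∸_; _≤_; _<_; _<?_; z≤n; NonZero)
open import Data.Nat.ListAction using (sum)
open import Data.Product using (_,_)
open import Level using (0ℓ)
open import Relation.Binary.Bundles using (Setoid)
open import Relation.Binary.PropositionalEquality using (_≡_; _≢_; refl; sym; trans)
open import Relation.Unary using (Pred; _∩_)

-- Rows and columns are indexed from 0, so part p r is the (r + 1)-st part.
-- For a weakly decreasing sequence of naturals, finite size means eventually
-- zero; bound is any index from which all parts vanish, not necessarily the
-- least one, and nothing below depends on which one was chosen.
record Partition : Set where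
  field
    part       : ℕ → ℕ
    decreasing : ∀ r → part (suc r) ≤ part r
    bound      : ℕ
    vanishes   : ∀ r → bound ≤ r → part r ≡ 0

open Partition public

-- Two partitions are equal when their parts are: bound and the proofs are
-- witnesses, not data.
infix 4 _≈_
_≈_ : Partition → Partition → Set
p ≈ q = ∀ r → part p r ≡ part q r

partitionSetoid : Setoid 0ℓ 0ℓ
partitionSetoid = record
  { Carrier       = Partition
  ; _≈_           = _≈_
  ; isEquivalence = record
      { refl  = λ _ → refl
      ; sym   = λ e r → sym (e r)
      ; trans = λ e f r → trans (e r) (f r)
      }
  }

size : Partition → ℕ
size p = sum (applyUpTo (part p) (bound p))

-- The number of rows r with (r , c) in the diagram; rows from bound on are
-- empty and contribute nothing.
conjugate : Partition → ℕ → ℕ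
conjugate p c = length (filter (λ x → c <? x) (applyUpTo (part p) (bound p)))

InDiagram : Partition → ℕ → ℕ → Set
InDiagram p r c = c < part p r

-- With indices from 0, the 1-based r and c become suc r and suc c.  The
-- subtractions are exact whenever (r , c) lies in the diagram.
hookLength : Partition → ℕ → ℕ → ℕ
hookLength p r c = 1 + (part p r ∸ suc c) + (conjugate p c ∸ suc r)

IsCore : ℕ → Pred Partition 0ℓ
IsCore s p = ∀ r c → InDiagram p r c → hookLength p r c ≢ s

open Membership partitionSetoid using (_∈_)
open Uniqueness partitionSetoid using (Unique)

-- A witness that P is finite: each partition satisfying P is listed, up to _≈_,
-- exactly once, and nothing else is.  Such a list is determined up to order
-- (and up to _≈_), so ∑ does not depend on the choice of witness when the
-- summand respects _≈_.
record Enumeration (P : Pred Partition 0ℓ) : Set where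
  field
    elements : List Partition
    sound    : All P elements
    complete : ∀ p → P p → p ∈ elements
    unique   : Unique elements

open Enumeration public

∑ : {P : Pred Partition 0ℓ} → Enumeration P → (Partition → ℕ) → ℕ
∑ E f = sum (map f (elements E))

emptyPartition : Partition
emptyPartition = record
  { part       = λ _ → 0
  ; decreasing = λ _ → z≤n
  ; bound      = 0
  ; vanishes   = λ _ _ → refl
  }

emptyPartition-core : ∀ s → IsCore s emptyPartition
emptyPartition-core s r c ()

-- The empty partition is always a simultaneous core, so the mean is defined.
∑1-nonZero : ∀ {s t} (E : Enumeration (IsCore s ∩ IsCore t)) → NonZero (∑ E (λ _ → 1))
∑1-nonZero {s} {t} E
  with elements E | complete E emptyPartition (emptyPartition-core s , emptyPartition-core t)
... | _ ∷ _ | _ = _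

{-# OPTIONS --safe #-}
module Submission where

-- Encode a partition by its beads part r + (n - 1 - r), r < n, for n the number
-- of nonzero parts.  It is an s-core exactly when the set of beads is closed under
-- subtracting s.  Such a set is determined by its first gaps, one per residue
-- class modulo s.  Let f j be the first gap in the class of j t; closure under
-- subtracting t says that f (j + 1) = f j + t - s z_j with z_j ≥ 0, and z_0, …,
-- z_(s-1) add up to t.  So the simultaneous cores correspond to the compositions z
-- of t into s parts whose walk j t - s (z_0 + … + z_(j-1)) never goes negative,
-- and by the cycle lemma every composition has exactly one such rotation.
--
-- The size is quadratic in the first gaps: 24 s² |λ| + s² (s² - 1) is 6 times
-- the sum of (f j - f k)² over all j, k < s.  Rotating z by k turns the walk
-- into f (j + k) - f k, so summing over all cores amounts to summing the squares
-- of the walk over all compositions, that is, to the second moment of a prefix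
-- sum of a random composition.

open import Data.Fin as Fin using (toℕ)
open import Data.Fin.Properties using (toℕ-fromℕ<; toℕ<n; toℕ-injective)
open import Data.List using (List; []; _∷_; _++_; length; filter; map; applyUpTo; downFrom)
open import Data.List.Properties
  using (filter-accept; filter-reject; length-filter; length-applyUpTo; length-downFrom; map-id; map-∘)
open import Data.List.Membership.Propositional using () renaming (_∈_ to _∈ₗ_; _∉_ to _∉ₗ_)
open import Data.List.Membership.Propositional.Properties
  using (∈-map⁺; ∈-map⁻; ∈-++⁺ˡ; ∈-++⁺ʳ; ∈-++⁻; ∈-applyUpTo⁺; ∈-applyUpTo⁻; ∈-downFrom⁺; ∈-downFrom⁻; ∈-filter⁺; ∈-filter⁻)
open import Data.List.Membership.Propositional.Properties.WithK using (unique∧set⇒bag)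
open import Data.List.Relation.Binary.BagAndSetEquality using (∼bag⇒↭)
open import Data.List.Relation.Binary.Permutation.Propositional as ↭ using (_↭_)
open import Data.List.Relation.Unary.All as All using (All; []; _∷_)
import Data.List.Relation.Unary.All.Properties as All
open import Data.List.Relation.Unary.AllPairs using (AllPairs; []; _∷_)
import Data.List.Relation.Unary.AllPairs.Properties as AllPairs
open import Data.List.Relation.Unary.Any as Any using (here; there)
import Data.List.Relation.Unary.Any.Properties as Any
open import Data.List.Relation.Unary.Unique.Propositional using (Unique)
import Data.List.Relation.Unary.Unique.Propositional.Properties as Unique
open import Data.Nat as ℕ using (ℕ; zero; suc; _≥_; z≤n; s≤s; NonZero; _%_)
open import Data.Nat.Coprimality using (Coprime; coprime-Bézout)
open import Data.Nat.DivMod using ([m+kn]%n≡m%n; [m+n]%n≡m%n; m%n<n; m<n⇒m%n≡m; m%n%n≡m%n; m%n≤m; m≡m%n+[m/n]*n)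
open import Data.Nat.GCD using (module Bézout)
open import Data.Nat.ListAction using (sum)
import Data.Nat.Properties as ℕ
open import Data.Product using (∃; Σ-syntax; _×_; _,_; proj₁; proj₂)
open import Data.Sum using (_⊎_; inj₁; inj₂)
open import Data.Vec as Vec using (Vec; []; _∷_; tabulate; lookup)
open import Data.Vec.Properties using (lookup∘tabulate; tabulate∘lookup; tabulate-cong)
open import Function using (_∘_; mk⇔)
open import Level using (0ℓ)
open import Relation.Binary.PropositionalEquality
  using (_≡_; _≢_; refl; sym; trans; cong; cong₂; subst; subst₂; module ≡-Reasoning)
open import Relation.Nullary using (¬_; Dec; yes; no; contradiction)
open import Relation.Nullary.Decidable using (decidable-stable; ¬?)
open import Relation.Unary using (Pred; Decidable; _∩_)
open import Defs

-- The number of simultaneous cores is never computed. Each core accounts for s compositions, so the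
-- number of compositions is s times the number of cores. All moments are multiples of the number of
-- compositions, so both counts drop out of the mean.
--
-- The second moment is simple because the walk is centred: over all compositions of t into s parts,
-- a prefix of j parts has mean j t / s, and its variance is proportional to j (s - j).
--
-- The 24 is 2 times 12. The size is half a quadratic expression in number and sum of beads, and 12
-- clears the denominator in the value s² (s² - 1) / 12 that this expression takes, up to scaling,
-- at the gaps 0, ..., s - 1 of the empty partition.
--
-- Beads depend on the chosen `bound`, not only on the parts: a larger bound shifts every bead and
-- adds small ones. Partitions are therefore first reduced to their nonzero parts. Division is
-- postponed throughout: identities are multiplied by s, s + 1, 6 or 24 and cancelled at the end.

module _ where

  open import Data.Nat using (_+_; _*_; _∸_; _/_; _≤_; _<_; _>_; _<?_; _≤?_)
  open import Data.Nat.Properties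
  open import Data.Nat.DivMod using (%-distribˡ-+; %-distribˡ-*; /-monoˡ-≤; m*n/n≡m; m*n%n≡0; _mod_)
  open import Data.Nat.Tactic.RingSolver using (solve-∀)
  open import Data.List.Membership.DecPropositional _≟_ using (_∈?_)

  -- Hooks, beads and gaps

  least : {P : Pred ℕ 0ℓ} → Decidable P → ∀ n → P n →
          ∃ λ m → P m × m ≤ n × (∀ {k} → k < m → ¬ P k)
  least P? zero    p = 0 , p , z≤n , λ ()
  least {P} P? (suc n) p with P? 0
  ... | yes p₀ = 0 , p₀ , z≤n , λ ()
  ... | no ¬p₀ with least (P? ∘ suc) n p
  ...   | m , pm , m≤n , below = suc m , pm , s≤s m≤n , below′
    where
    below′ : ∀ {k} → k < suc m → ¬ P k
    below′ {zero}  _         = ¬p₀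
    below′ {suc k} (s≤s k<m) = below k<m

  Antitone : (ℕ → ℕ) → Set
  Antitone g = ∀ r → g (suc r) ≤ g r

  antitone-≤ : ∀ {g} → Antitone g → ∀ {q r} → q ≤ r → g r ≤ g q
  antitone-≤ {g} anti {r = zero}  z≤n = ≤-refl
  antitone-≤ {g} anti {r = suc r} q≤r with m≤n⇒m<n∨m≡n q≤r
  ... | inj₁ (s≤s q≤r′) = ≤-trans (anti r) (antitone-≤ {g} anti q≤r′)
  ... | inj₂ refl       = ≤-refl

  -- The body of `conjugate` for an arbitrary sequence, so that inductions can pass to `g ∘ suc`.
  countAbove : (ℕ → ℕ) → ℕ → ℕ → ℕ
  countAbove g c b = length (filter (λ x → c <? x) (applyUpTo g b))

  <countAbove⇒above : ∀ g → Antitone g → ∀ c b {r} → r < countAbove g c b → c < g r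
  <countAbove⇒above g anti c (suc b) {r} r< with c <? g 0
  ... | no c≮ = ≤-trans (<countAbove⇒above (g ∘ suc) (anti ∘ suc) c b
                  (subst (λ l → r < length l) (filter-reject (c <?_) c≮) r<)) (anti r)
  <countAbove⇒above g anti c (suc b) {zero}  r< | yes c< = c<
  <countAbove⇒above g anti c (suc b) {suc r} r< | yes c< =
    <countAbove⇒above (g ∘ suc) (anti ∘ suc) c b
      (≤-pred (subst (λ l → suc r < length l) (filter-accept (c <?_) c<) r<))

  above⇒<countAbove : ∀ g → Antitone g → ∀ c b {r} → r < b → c < g r → r < countAbove g c b
  above⇒<countAbove g anti c (suc b) {r} r<b c<gr with c <? g 0
  ... | no c≮ = contradiction (≤-trans c<gr (antitone-≤ {g} anti {0} {r} z≤n)) c≮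
  above⇒<countAbove g anti c (suc b) {zero} r<b c<gr | yes c< =
    subst (λ l → 0 < length l) (sym (filter-accept (c <?_) c<)) (s≤s z≤n)
  above⇒<countAbove g anti c (suc b) {suc r} (s≤s r<b) c<gr | yes c< =
    subst (λ l → suc r < length l) (sym (filter-accept (c <?_) c<))
      (s≤s (above⇒<countAbove (g ∘ suc) (anti ∘ suc) c b r<b c<gr))

  -- Here l is the length of row r, k the height of column c and n the bound. The hypotheses make
  -- every truncated subtraction exact; u, w and y are the differences that replace them.
  hook-identity : ∀ {r c l k n} → c < l → r < k → k ≤ n →
                  l + (n ∸ suc r) ≡ c + (n ∸ k) + (1 + (l ∸ suc c) + (k ∸ suc r))
  hook-identity {r} {c} c<l r<k k≤n
    with m≤n⇒∃[o]m+o≡n c<l | m≤n⇒∃[o]m+o≡n r<k | m≤n⇒∃[o]m+o≡n k≤n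
  ... | u , refl | w , refl | y , refl
    rewrite m+n∸m≡n c u | m+n∸m≡n r w | m+n∸m≡n (r + w) y
          | +-assoc r w y | m+n∸m≡n r (w + y) = identity c u w y
    where
    identity : ∀ c u w y → suc c + u + (w + y) ≡ c + y + (suc u + w)
    identity = solve-∀

  -- When bound p is the number of nonzero parts, the beads are the hook lengths
  -- in the first column; the naturals that are not beads are the numbers gap p c.
  module _ (p : Partition) where

    bead : ℕ → ℕ
    bead r = part p r + (bound p ∸ suc r)

    beads : List ℕ
    beads = applyUpTo bead (bound p)

    gap : ℕ → ℕ
    gap c = c + (bound p ∸ conjugate p c)

    <conjugate⇒InDiagram : ∀ {r c} → r < conjugate p c → InDiagram p r c
    <conjugate⇒InDiagram {c = c} = <countAbove⇒above (part p) (decreasing p) c (bound p)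

    InDiagram⇒<bound : ∀ {r c} → InDiagram p r c → r < bound p
    InDiagram⇒<bound {r} c< with r <? bound p
    ... | yes r< = r<
    ... | no r≮ = contradiction (subst (_ <_) (vanishes p r (≮⇒≥ r≮)) c<) λ ()

    InDiagram⇒<conjugate : ∀ {r c} → InDiagram p r c → r < conjugate p c
    InDiagram⇒<conjugate {r} {c} c< =
      above⇒<countAbove (part p) (decreasing p) c (bound p) (InDiagram⇒<bound {r} {c} c<) c<

    conjugate≤bound : ∀ c → conjugate p c ≤ bound p
    conjugate≤bound c = ≤-trans (length-filter (c <?_) (applyUpTo (part p) (bound p)))
                                (≤-reflexive (length-applyUpTo (part p) (bound p)))

    bead≡gap+hook : ∀ {r c} → InDiagram p r c → bead r ≡ gap c + hookLength p r c
    bead≡gap+hook {r} {c} c< =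
      hook-identity c< (InDiagram⇒<conjugate {r} {c} c<) (conjugate≤bound c)

    bead<gap : ∀ {r c} → r < bound p → part p r ≤ c → bead r < gap c
    bead<gap {r} {c} r<N part≤c = +-mono-≤-< part≤c (∸-monoʳ-< (s≤s conj≤r) r<N)
      where
      conj≤r : conjugate p c ≤ r
      conj≤r with r <? conjugate p c
      ... | yes r< = contradiction part≤c (<⇒≱ (<conjugate⇒InDiagram {r} {c} r<))
      ... | no r≮  = ≮⇒≥ r≮

    -- A cell inside the diagram puts the bead above the gap by a positive hook length; a cell
    -- outside puts it strictly below.
    bead≢gap : ∀ {r c} → r < bound p → bead r ≢ gap c
    bead≢gap {r} {c} r<N eq with c <? part p r
    ... | no  c≮ = <⇒≢ (bead<gap {r} {c} r<N (≮⇒≥ c≮)) eq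
    ... | yes c< = m≢1+m+n (gap c) (trans (sym eq) (trans (bead≡gap+hook {r} {c} c<) (+-suc (gap c) _)))

    gap∉beads : ∀ c → gap c ∉ₗ beads
    gap∉beads c g∈ with r , r< , eq ← ∈-applyUpTo⁻ bead g∈ = bead≢gap {r} {c} r< (sym eq)

    private
      -- bead r ≤ x, with both sides moved so that no subtraction occurs.
      Passed : ℕ → Pred ℕ 0ℓ
      Passed x r = part p r + bound p ≤ x + suc r

      passed-bound : ∀ x → Passed x (bound p)
      passed-bound x rewrite vanishes p (bound p) ≤-refl = ≤-trans (n≤1+n _) (m≤n+m _ x)

    -- If r is the first row whose bead does not exceed x then either that bead
    -- is x, or x is the gap of the column c = x + r - bound p, of height r.
    bead⊎gap : ∀ x → x ∈ₗ beads ⊎ ∃ λ c → gap c ≡ x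
    bead⊎gap x with least (λ r → part p r + bound p ≤? x + suc r) (bound p) (passed-bound x)
    ... | r , passed , r≤N , above with m≤n⇒m<n∨m≡n passed
    ...   | inj₂ eq = inj₁ (subst (_∈ₗ beads) bead≡x (∈-applyUpTo⁺ bead r<N))
      where
      r<N : r < bound p
      r<N with r <? bound p
      ... | yes r< = r<
      ... | no r≮  = contradiction (m+n≤o⇒n≤o x (≤-reflexive (trans (sym eq) (cong (_+ bound p) (vanishes p r (≮⇒≥ r≮))))))
                       (≤⇒≯ (≮⇒≥ r≮))
      bead≡x : bead r ≡ x
      bead≡x = trans (sym (+-∸-assoc (part p r) r<N)) (trans (cong (_∸ suc r) eq) (m+n∸n≡m x (suc r)))
    ...   | inj₁ below = inj₂ (c , gap≡x)
      where
      part+N≤ : part p r + bound p ≤ x + r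
      part+N≤ = ≤-pred (≤-trans below (≤-reflexive (+-suc x r)))
      N≤ : bound p ≤ x + r
      N≤ = m+n≤o⇒n≤o (part p r) part+N≤
      c : ℕ
      c = x + r ∸ bound p
      c+N : c + bound p ≡ x + r
      c+N = m∸n+n≡m N≤
      part≤c : part p r ≤ c
      part≤c = +-cancelʳ-≤ (bound p) (part p r) c (≤-trans part+N≤ (≤-reflexive (sym c+N)))
      -- Row r - 1 fails `Passed`, so it reaches beyond column c, and that single row suffices. The
      -- equation ties q to r while c stays fixed under the case split.
      r≤conjugate : ∀ q → (∀ {k} → k < q → ¬ Passed x k) → x + q ≡ x + r → q ≤ conjugate p c
      r≤conjugate zero    _     _  = z≤n
      r≤conjugate (suc q) above eq = InDiagram⇒<conjugate {q} {c}
        (+-cancelʳ-< (bound p) c (part p q)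
          (≤-trans (≤-reflexive (cong suc (trans c+N (sym eq)))) (≰⇒> (above ≤-refl))))
      conjugate≡r : conjugate p c ≡ r
      conjugate≡r = ≤-antisym
        (≮⇒≥ λ r< → contradiction part≤c (<⇒≱ (<conjugate⇒InDiagram {r} {c} r<)))
        (r≤conjugate r above refl)
      gap≡x : gap c ≡ x
      gap≡x rewrite conjugate≡r = trans (sym (+-∸-assoc c r≤N)) (trans (cong (_∸ r) c+N) (m+n∸n≡m x r))

  -- Cores as bead sets closed under subtraction

  Closed : ℕ → Pred ℕ 0ℓ → Set
  Closed s B = ∀ x → B (x + s) → B x

  -- If x were not a bead it would be the gap of some column c, while x + s is the bead of some row
  -- r. A cell (r , c) inside the diagram would then have hook length s; outside it, the bead x + s
  -- would lie below the gap x.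
  core⇒closed : ∀ {s} p → IsCore s p → 1 ≤ s → Closed s (_∈ₗ beads p)
  core⇒closed {s} p core s≥1 x x+s∈ with bead⊎gap p x | ∈-applyUpTo⁻ (bead p) x+s∈
  ... | inj₁ x∈         | _ = x∈
  ... | inj₂ (c , refl) | r , r<N , eq with c <? part p r
  ...   | yes c< = contradiction
                     (+-cancelˡ-≡ (gap p c) _ _ (trans (sym (bead≡gap+hook p {r} {c} c<)) (sym eq)))
                     (core r c c<)
  ...   | no c≮  = contradiction (<⇒≤ (bead<gap p {r} {c} r<N (≮⇒≥ c≮)))
                     (<⇒≱ (subst (gap p c <_) eq (m<m+n (gap p c) s≥1)))

  -- A hook of length s in column c would make `gap p c + s` a bead, and closure would make the gap
  -- itself one.
  closed⇒core : ∀ {s} p → Closed s (_∈ₗ beads p) → IsCore s p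
  closed⇒core p closed r c c< refl = gap∉beads p c
    (closed (gap p c) (subst (_∈ₗ beads p) (bead≡gap+hook p {r} {c} c<)
      (∈-applyUpTo⁺ (bead p) (InDiagram⇒<bound p {r} {c} c<))))

  conjugate-cong : ∀ {p q} → p ≈ q → ∀ c → conjugate p c ≡ conjugate q c
  conjugate-cong {p} {q} p≈q c = ≤-antisym (half p q p≈q) (half q p (λ r → sym (p≈q r)))
    where
    half : ∀ p q → p ≈ q → conjugate p c ≤ conjugate q c
    half p q p≈q with conjugate p c in eq
    ... | zero  = z≤n
    ... | suc k = InDiagram⇒<conjugate q {k} {c}
      (subst (c <_) (p≈q k) (<conjugate⇒InDiagram p {k} {c} (≤-reflexive (sym eq))))

  core-resp-≈ : ∀ {s p q} → p ≈ q → IsCore s p → IsCore s q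
  core-resp-≈ {s} {p} {q} p≈q core r c c< eq = core r c (subst (c <_) (sym (p≈q r)) c<)
    (trans (cong₂ (λ l k → 1 + (l ∸ suc c) + (k ∸ suc r)) (p≈q r) (conjugate-cong {p} {q} p≈q c)) eq)

  -- Forces `bound p` to be the exact number of nonzero parts. The beads then depend only on the
  -- parts, and 0 is not among them.
  Reduced : Partition → Set
  Reduced p = ∀ {r} → r < bound p → 0 < part p r

  reduce : ∀ p → ∃ λ q → Reduced q × p ≈ q
  reduce p with least (λ r → part p r ≟ 0) (bound p) (vanishes p (bound p) ≤-refl)
  ... | n , part≡0 , _ , above =
    record { part = part p ; decreasing = decreasing p ; bound = n
           ; vanishes = λ r n≤r → n≤0⇒n≡0 (≤-trans (antitone-≤ {part p} (decreasing p) n≤r) (≤-reflexive part≡0)) }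
    , (λ r<n → n≢0⇒n>0 (above r<n)) , λ _ → refl

  reduced⇒0∉beads : ∀ {p} → Reduced p → 0 ∉ₗ beads p
  reduced⇒0∉beads {p} reduced 0∈ with r , r<N , eq ← ∈-applyUpTo⁻ (bead p) 0∈ =
    <⇒≢ (≤-trans (reduced r<N) (m≤m+n _ _)) eq

  -- Partitions with prescribed beads

  StrictlyDecreasing : List ℕ → Set
  StrictlyDecreasing = AllPairs _>_

  length≤head : ∀ {x xs} → StrictlyDecreasing (x ∷ xs) → length xs ≤ x
  length≤head {xs = []}     _                     = z≤n
  length≤head {xs = y ∷ ys} ((x>y ∷ _) ∷ y>ys ∷ d) = ≤-trans (s≤s (length≤head (y>ys ∷ d))) x>y

  -- Inverts `bead`: the number of entries after position r is the summand `bound p ∸ suc r`.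
  partOf : List ℕ → ℕ → ℕ
  partOf []       _       = 0
  partOf (x ∷ xs) zero    = x ∸ length xs
  partOf (x ∷ xs) (suc r) = partOf xs r

  partOf-decreasing : ∀ {xs} → StrictlyDecreasing xs → Antitone (partOf xs)
  partOf-decreasing {[]}         _                       _       = z≤n
  partOf-decreasing {_ ∷ []}     _                       zero    = z≤n
  partOf-decreasing {x ∷ y ∷ ys} ((x>y ∷ _) ∷ _)         zero    = ∸-monoˡ-≤ (suc (length ys)) x>y
  partOf-decreasing {_ ∷ _}      (_ ∷ d)                 (suc r) = partOf-decreasing d r

  partOf-vanishes : ∀ xs r → length xs ≤ r → partOf xs r ≡ 0
  partOf-vanishes []       _       _        = refl
  partOf-vanishes (_ ∷ xs) (suc r) (s≤s le) = partOf-vanishes xs r le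

  fromBeads : ∀ xs → StrictlyDecreasing xs → Partition
  fromBeads xs d = record
    { part       = partOf xs
    ; decreasing = partOf-decreasing d
    ; bound      = length xs
    ; vanishes   = partOf-vanishes xs
    }

  beads-fromBeads : ∀ {xs} (d : StrictlyDecreasing xs) → beads (fromBeads xs d) ≡ xs
  beads-fromBeads {[]}     []      = refl
  beads-fromBeads {x ∷ xs} d@(_ ∷ d′) = cong₂ _∷_ (m∸n+n≡m (length≤head d)) (beads-fromBeads d′)

  beads-strictlyDecreasing : ∀ p → StrictlyDecreasing (beads p)
  beads-strictlyDecreasing p = AllPairs.applyUpTo⁺₁ (bead p) (bound p) λ {i} {j} i<j j<N →
    +-mono-≤-< (antitone-≤ {part p} (decreasing p) (<⇒≤ i<j)) (∸-monoʳ-< (s≤s i<j) j<N)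

  strictlyDecreasing-unique : ∀ {xs ys} → StrictlyDecreasing xs → StrictlyDecreasing ys →
    (∀ {x} → x ∈ₗ xs → x ∈ₗ ys) → (∀ {x} → x ∈ₗ ys → x ∈ₗ xs) → xs ≡ ys
  strictlyDecreasing-unique {[]} {[]} _ _ _ _ = refl
  strictlyDecreasing-unique {[]} {_ ∷ _} _ _ _ ⊇ with () ← ⊇ (here refl)
  strictlyDecreasing-unique {_ ∷ _} {[]} _ _ ⊆ _ with () ← ⊆ (here refl)
  strictlyDecreasing-unique {x ∷ xs} {y ∷ ys} (x> ∷ dx) (y> ∷ dy) ⊆ ⊇ =
    cong₂ _∷_ x≡y (strictlyDecreasing-unique dx dy tail⊆ tail⊇)
    where
    ≤head : ∀ {z w ws} → All (w >_) ws → z ∈ₗ (w ∷ ws) → z ≤ w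
    ≤head w>  (here refl) = ≤-refl
    ≤head w>  (there z∈)  = <⇒≤ (All.lookup w> z∈)
    x≡y : x ≡ y
    x≡y = ≤-antisym (≤head y> (⊆ (here refl))) (≤head x> (⊇ (here refl)))
    tail⊆ : ∀ {z} → z ∈ₗ xs → z ∈ₗ ys
    tail⊆ z∈ with ⊆ (there z∈)
    ... | here z≡y  = contradiction (trans z≡y (sym x≡y)) (<⇒≢ (All.lookup x> z∈))
    ... | there z∈′ = z∈′
    tail⊇ : ∀ {z} → z ∈ₗ ys → z ∈ₗ xs
    tail⊇ z∈ with ⊇ (there z∈)
    ... | here z≡x  = contradiction (trans z≡x x≡y) (<⇒≢ (All.lookup y> z∈))
    ... | there z∈′ = z∈′

  beads-injective : ∀ p q → beads p ≡ beads q → p ≈ q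
  beads-injective p q eq r =
    trans (parts p r) (trans (cong (λ xs → partOf xs r) eq) (sym (parts q r)))
    where
    partOf-applyUpTo : ∀ g n r → r < n → partOf (applyUpTo (λ i → g i + (n ∸ suc i)) n) r ≡ g r
    partOf-applyUpTo g (suc n) zero    _ =
      trans (cong (g 0 + n ∸_) (length-applyUpTo _ n)) (m+n∸n≡m (g 0) n)
    partOf-applyUpTo g (suc n) (suc r) (s≤s r<n) = partOf-applyUpTo (g ∘ suc) n r r<n
    parts : ∀ p r → part p r ≡ partOf (beads p) r
    parts p r with r <? bound p
    ... | yes r< = sym (partOf-applyUpTo (part p) (bound p) r r<)
    ... | no r≮  = trans (vanishes p r (≮⇒≥ r≮)) (sym (partOf-vanishes (beads p) r
      (≤-trans (≤-reflexive (length-applyUpTo (bead p) (bound p))) (≮⇒≥ r≮))))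

  reduced-bound-≤ : ∀ {p q} → Reduced p → p ≈ q → bound p ≤ bound q
  reduced-bound-≤ {p} {q} reduced p≈q = ≮⇒≥ λ lt →
    <⇒≢ (reduced lt) (sym (trans (p≈q (bound q)) (vanishes q (bound q) ≤-refl)))

  applyUpTo-cong : ∀ {f g : ℕ → ℕ} → (∀ i → f i ≡ g i) → ∀ n → applyUpTo f n ≡ applyUpTo g n
  applyUpTo-cong eq zero    = refl
  applyUpTo-cong eq (suc n) = cong₂ _∷_ (eq 0) (applyUpTo-cong (eq ∘ suc) n)

  beads-cong : ∀ {p q} → Reduced p → Reduced q → p ≈ q → beads p ≡ beads q
  beads-cong {p} {q} rp rq p≈q
    with N≡ ← ≤-antisym (reduced-bound-≤ {p} {q} rp p≈q) (reduced-bound-≤ {q} {p} rq (λ r → sym (p≈q r))) =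
    trans (applyUpTo-cong (λ r → cong₂ (λ l n → l + (n ∸ suc r)) (p≈q r) N≡) (bound p))
          (cong (applyUpTo (bead q)) N≡)

  fromBeads-reduced : ∀ {xs} (d : StrictlyDecreasing xs) → 0 ∉ₗ xs → Reduced (fromBeads xs d)
  fromBeads-reduced {x ∷ []} _ 0∉ {zero} _ = n≢0⇒n>0 λ x≡0 → 0∉ (here (sym x≡0))
  fromBeads-reduced {x ∷ y ∷ ys} d@((x>y ∷ _) ∷ d′) 0∉ {zero} _ =
    ≤-trans (fromBeads-reduced d′ (0∉ ∘ there) {0} (s≤s z≤n))
            (∸-monoˡ-≤ (suc (length ys)) x>y)
  fromBeads-reduced {_ ∷ _} (_ ∷ d) 0∉ {suc r} (s≤s r<) = fromBeads-reduced d (0∉ ∘ there) r<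

  -- The beads exceed the parts by n - 1, ..., 1, 0, in total n (n - 1) / 2; doubling and moving n
  -- across avoids division and subtraction.
  sum-beads : ∀ p → 2 * sum (beads p) + bound p ≡ 2 * size p + bound p * bound p
  sum-beads p = go (part p) (bound p)
    where
    identity₁ : ∀ g n σ → 2 * (g + n + σ) + suc n ≡ 2 * g + 2 * n + 1 + (2 * σ + n)
    identity₁ = solve-∀
    identity₂ : ∀ g n τ → 2 * g + 2 * n + 1 + (2 * τ + n * n) ≡ 2 * (g + τ) + suc n * suc n
    identity₂ = solve-∀
    go : ∀ g n → 2 * sum (applyUpTo (λ r → g r + (n ∸ suc r)) n) + n ≡ 2 * sum (applyUpTo g n) + n * n
    go g zero    = refl
    go g (suc n) = trans (identity₁ (g 0) n _)
      (trans (cong (2 * g 0 + 2 * n + 1 +_) (go (g ∘ suc) n)) (identity₂ (g 0) n _))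

  -- First gaps modulo s

  module _ (s : ℕ) .{{_ : NonZero s}} where

    infix 4 _≡ₛ_
    _≡ₛ_ : ℕ → ℕ → Set
    m ≡ₛ n = m % s ≡ n % s

    +-congₛ : ∀ {m m′ n n′} → m ≡ₛ m′ → n ≡ₛ n′ → m + n ≡ₛ m′ + n′
    +-congₛ {m} {m′} {n} {n′} p q = trans (%-distribˡ-+ m n s)
      (trans (cong₂ (λ x y → (x + y) % s) p q) (sym (%-distribˡ-+ m′ n′ s)))

    *-congₛ : ∀ {m m′ n n′} → m ≡ₛ m′ → n ≡ₛ n′ → m * n ≡ₛ m′ * n′
    *-congₛ {m} {m′} {n} {n′} p q = trans (%-distribˡ-* m n s)
      (trans (cong₂ (λ x y → (x * y) % s) p q) (sym (%-distribˡ-* m′ n′ s)))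

    ≡ₛ-difference : ∀ {m n} → m ≡ₛ n → m ≤ n → ∃ λ k → n ≡ m + k * s
    ≡ₛ-difference {m} {n} m≡n m≤n with m≤n⇒∃[o]m+o≡n (/-monoˡ-≤ s m≤n)
    ... | k , eq = k , (begin
      n                          ≡⟨ m≡m%n+[m/n]*n n s ⟩
      n % s + n / s * s          ≡⟨ cong₂ (λ r q → r + q * s) m≡n eq ⟨
      m % s + (m / s + k) * s    ≡⟨ rearrange (m % s) (m / s) k s ⟩
      m % s + m / s * s + k * s  ≡⟨ cong (_+ k * s) (m≡m%n+[m/n]*n m s) ⟨
      m + k * s                  ∎)
      where
      open ≡-Reasoning
      rearrange : ∀ r q k s → r + (q + k) * s ≡ r + q * s + k * s
      rearrange = solve-∀

    ≡ₛ-<⇒+≤ : ∀ {m n} → m ≡ₛ n → m < n → m + s ≤ n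
    ≡ₛ-<⇒+≤ {m} m≡n m<n with ≡ₛ-difference m≡n (<⇒≤ m<n)
    ... | zero  , refl = contradiction (+-identityʳ m) (<⇒≢ m<n ∘ sym)
    ... | suc k , refl = +-monoʳ-≤ m (m≤m+n s (k * s))

    inverse : ∀ {t} → Coprime s t → ∃ λ u → t * u ≡ₛ 1
    inverse {t} coprime with coprime-Bézout coprime
    ... | Bézout.-+ x y eq = y , (begin
      (t * y) % s      ≡⟨ cong (_% s) (trans (*-comm t y) (sym eq)) ⟩
      (1 + x * s) % s  ≡⟨ [m+kn]%n≡m%n 1 x s ⟩
      1 % s            ∎)
      where open ≡-Reasoning
    -- Here 1 + y t = x s, so y inverts - t modulo s; the factor s - 1 stands for - 1.
    ... | Bézout.+- x y eq = y * (s ∸ 1) , (begin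
      (t * (y * (s ∸ 1))) % s          ≡⟨ [m+n]%n≡m%n (t * (y * (s ∸ 1))) s ⟨
      (t * (y * (s ∸ 1)) + s) % s      ≡⟨ cong (_% s) (go (s ∸ 1) (m∸n+n≡m (n≢0⇒n>0 (ℕ.≢-nonZero⁻¹ s)))) ⟩
      (1 + (x * (s ∸ 1)) * s) % s      ≡⟨ [m+kn]%n≡m%n 1 (x * (s ∸ 1)) s ⟩
      1 % s                            ∎)
      where
      open ≡-Reasoning
      expand : ∀ t y r → t * (y * r) + (r + 1) ≡ 1 + r * (1 + y * t)
      expand = solve-∀
      regroup : ∀ x r s → r * (x * s) ≡ x * r * s
      regroup = solve-∀
      go : ∀ r → r + 1 ≡ s → t * (y * r) + s ≡ 1 + x * r * s
      go r refl = trans (expand t y r) (cong (1 +_) (trans (cong (r *_) eq) (regroup x r s)))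

    -- a x is the least non-bead in the residue class of x modulo s, so that x is
    -- a bead exactly when x < a x.
    record IsGapFunction (t : ℕ) (a : ℕ → ℕ) : Set where
      field
        residue  : ∀ x → a x ≡ₛ x
        periodic : ∀ {x y} → x ≡ₛ y → a x ≡ a y
        -- This encodes closure under subtracting t: x + t < a (x + t) yields x < a x. The field
        -- after it says that 0 is not a bead, as for reduced partitions.
        step     : ∀ x → a (x + t) ≤ a x + t
        at-zero  : a 0 ≡ 0

    open IsGapFunction

    module _ (a : ℕ → ℕ) (U : ℕ) where

      beadList : List ℕ
      beadList = filter (λ x → x <? a x) (downFrom U)

      beadList-decreasing : StrictlyDecreasing beadList
      beadList-decreasing = AllPairs.filter⁺ (λ x → x <? a x) (AllPairs.applyDownFrom⁺₁ (λ x → x) U (λ j<i _ → j<i))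

      toPartition : Partition
      toPartition = fromBeads beadList beadList-decreasing

      bead⁻ : ∀ {x} → x ∈ₗ beads toPartition → x < a x
      bead⁻ {x} x∈ = proj₂ (∈-filter⁻ (λ x → x <? a x) {xs = downFrom U}
        (subst (x ∈ₗ_) (beads-fromBeads beadList-decreasing) x∈))

      bead⁺ : (∀ x → a x ≤ U) → ∀ {x} → x < a x → x ∈ₗ beads toPartition
      bead⁺ a≤U {x} x< = subst (x ∈ₗ_) (sym (beads-fromBeads beadList-decreasing))
        (∈-filter⁺ (λ x → x <? a x) (∈-downFrom⁺ (<-≤-trans x< (a≤U x))) x<)

    module _ {t : ℕ} {a : ℕ → ℕ} (isGap : IsGapFunction t a) where

      gap-idempotent : ∀ x → a (a x) ≡ a x
      gap-idempotent x = (periodic isGap (residue isGap x))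

      toPartition-reduced : ∀ U → Reduced (toPartition a U)
      toPartition-reduced U = fromBeads-reduced (beadList-decreasing a U) λ 0∈ →
        <⇒≢ (proj₂ (∈-filter⁻ (λ x → x <? a x) {xs = downFrom U} 0∈)) (sym (at-zero isGap))

      toPartition-core-s : ∀ {U} → (∀ x → a x ≤ U) → IsCore s (toPartition a U)
      toPartition-core-s {U} a≤U = closed⇒core (toPartition a U) λ x x+s∈ → bead⁺ a U a≤U
        (≤-<-trans (m≤m+n x s)
          (subst (x + s <_) (periodic isGap ([m+n]%n≡m%n x s)) (bead⁻ a U x+s∈)))

      toPartition-core-t : ∀ {U} → (∀ x → a x ≤ U) → IsCore t (toPartition a U)
      toPartition-core-t {U} a≤U = closed⇒core (toPartition a U) λ x x+t∈ → bead⁺ a U a≤U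
        (+-cancelʳ-< t x (a x) (<-≤-trans (bead⁻ a U x+t∈) (step isGap x)))

    -- If a x < b x, then a x, which lies in the class of x, is a bead for b and hence for a,
    -- although it is a gap of a.
    gapFunction-≤ : ∀ {t a b} → IsGapFunction t a → IsGapFunction t b →
                    (∀ x → x < b x → x < a x) → ∀ x → b x ≤ a x
    gapFunction-≤ {t} {a} {b} ga gb b⊆a x = ≮⇒≥ λ ax<bx → <⇒≢
      (b⊆a (a x) (<-≤-trans ax<bx (≤-reflexive (sym (periodic gb (residue ga x))))))
      (sym (gap-idempotent ga x))

    toPartition-injective : ∀ {t a b U} → IsGapFunction t a → IsGapFunction t b →
      (∀ x → a x ≤ U) → (∀ x → b x ≤ U) → toPartition a U ≈ toPartition b U → ∀ x → a x ≡ b x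
    toPartition-injective {t} {a} {b} {U} ga gb a≤ b≤ eq x =
      ≤-antisym (gapFunction-≤ gb ga (λ y → λ y< → bead⁻ b U (subst (y ∈ₗ_) beads≡ (bead⁺ a U a≤ y<))) x)
                (gapFunction-≤ ga gb (λ y → λ y< → bead⁻ a U (subst (y ∈ₗ_) (sym beads≡) (bead⁺ b U b≤ y<))) x)
      where
      beads≡ : beads (toPartition a U) ≡ beads (toPartition b U)
      beads≡ = beads-cong {toPartition a U} {toPartition b U} (toPartition-reduced ga U) (toPartition-reduced gb U) eq

    module _ {t : ℕ} (xs : List ℕ) (0∉ : 0 ∉ₗ xs) (closed-s : Closed s (_∈ₗ xs)) (closed-t : Closed t (_∈ₗ xs)) where

      closed-multiple : ∀ k {x} → x + k * s ∈ₗ xs → x ∈ₗ xs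
      closed-multiple zero    {x} x∈ = subst (_∈ₗ xs) (+-identityʳ x) x∈
      closed-multiple (suc k) {x} x∈ = closed-multiple k (closed-s (x + k * s)
        (subst (_∈ₗ xs) (trans (cong (x +_) (+-comm s (k * s))) (sym (+-assoc x (k * s) s))) x∈))

      private
        outside : ∃ λ N → ∀ {x} → x ∈ₗ xs → x < N
        outside = go xs
          where
          go : ∀ ys → ∃ λ N → ∀ {x} → x ∈ₗ ys → x < N
          go [] = 0 , λ ()
          go (y ∷ ys) with N , below ← go ys = suc y + N ,
            λ { (here refl) → m≤m+n (suc y) N ; (there x∈) → <-≤-trans (below x∈) (m≤n+m N (suc y)) }

        firstGap : ∀ r → ∃ λ m → r + m * s ∉ₗ xs × (∀ {k} → k < m → r + k * s ∈ₗ xs)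
        firstGap r with N , below ← outside
          -- All members of xs lie below N, and r + N * s is at least N, so the search may stop at
          -- N.
          with least (λ m → ¬? (r + m * s ∈? xs)) N
                 (λ x∈ → contradiction (below x∈)
                           (≤⇒≯ (≤-trans (m≤m*n N s) (m≤n+m (N * s) r))))
        ... | m , gap , _ , before = m , gap , λ k<m → decidable-stable (_ ∈? xs) (before k<m)

        a : ℕ → ℕ
        a x = x % s + proj₁ (firstGap (x % s)) * s

        a-residue : ∀ x → a x ≡ₛ x
        a-residue x = trans ([m+kn]%n≡m%n (x % s) (proj₁ (firstGap (x % s))) s) (m%n%n≡m%n x s)

        a-periodic : ∀ {x y} → x ≡ₛ y → a x ≡ a y
        a-periodic eq = cong (λ r → r + proj₁ (firstGap r) * s) eq

        a∉ : ∀ x → a x ∉ₗ xs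
        a∉ x = proj₁ (proj₂ (firstGap (x % s)))

        a⁺ : ∀ {x} → x ∈ₗ xs → x < a x
        a⁺ {x} x∈ = ≰⇒> λ ax≤x → let k , eq = ≡ₛ-difference (a-residue x) ax≤x in
          a∉ x (closed-multiple k (subst (_∈ₗ xs) eq x∈))

        a⁻ : ∀ {x} → x < a x → x ∈ₗ xs
        a⁻ {x} x< = subst (_∈ₗ xs) (sym (m≡m%n+[m/n]*n x s))
          (proj₂ (proj₂ (firstGap (x % s))) (*-cancelʳ-< s (x / s) _
            (+-cancelˡ-< (x % s) _ _ (subst (_< a x) (m≡m%n+[m/n]*n x s) x<))))

        -- Otherwise a x + t lies below the first gap of its own class, so it is a bead, and
        -- subtracting t makes the gap a x a bead.
        a-step : ∀ x → a (x + t) ≤ a x + t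
        a-step x = ≮⇒≥ λ lt → a∉ x (closed-t (a x) (a⁻ (<-≤-trans lt
          (≤-reflexive (a-periodic (+-congₛ {x} {a x} (sym (a-residue x)) refl))))))

      closed⇒gapFunction : ∃ λ a → IsGapFunction t a × (∀ {x} → x ∈ₗ xs → x < a x)
                                                   × (∀ {x} → x < a x → x ∈ₗ xs)
      closed⇒gapFunction = a , record
        { residue = a-residue ; periodic = a-periodic ; step = a-step
        ; at-zero = n≤0⇒n≡0 (≮⇒≥ λ 0< → 0∉ (a⁻ 0<)) } , a⁺ , a⁻

  -- Periodic sequences and their walks

  partialSum : (ℕ → ℕ) → ℕ → ℕ
  partialSum f zero    = 0
  partialSum f (suc j) = partialSum f j + f j

  partialSum-cong : ∀ {f g} → (∀ i → f i ≡ g i) → ∀ j → partialSum f j ≡ partialSum g j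
  partialSum-cong eq zero    = refl
  partialSum-cong eq (suc j) = cong₂ _+_ (partialSum-cong eq j) (eq j)

  partialSum-+ : ∀ f j k → partialSum f (j + k) ≡ partialSum f k + partialSum (λ i → f (i + k)) j
  partialSum-+ f zero    k = sym (+-identityʳ _)
  partialSum-+ f (suc j) k = trans (cong (_+ f (j + k)) (partialSum-+ f j k)) (+-assoc (partialSum f k) _ _)

  partialSum-suc : ∀ f j → partialSum f (suc j) ≡ f 0 + partialSum (f ∘ suc) j
  partialSum-suc f zero    = +-comm 0 (f 0)
  partialSum-suc f (suc j) = trans (cong (_+ f (suc j)) (partialSum-suc f j)) (+-assoc (f 0) _ _)

  -- Recursion on the vector follows the recursion of `compositions`, whereas `partialSum` of the
  -- periodic extension suits rotations; hence both forms.
  prefixSum : ∀ {n} → ℕ → Vec ℕ n → ℕ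
  prefixSum zero    _        = 0
  prefixSum (suc j) []       = 0
  prefixSum (suc j) (x ∷ xs) = x ℕ.+ prefixSum j xs

  prefixSum≡partialSum : ∀ {n} f (v : Vec ℕ n) → (∀ i → f (toℕ i) ≡ lookup v i) →
                         ∀ {j} → j ≤ n → prefixSum j v ≡ partialSum f j
  prefixSum≡partialSum f v       eq z≤n               = refl
  prefixSum≡partialSum f (x ∷ v) eq {suc j} (s≤s j≤n) = sym (trans (partialSum-suc f j)
    (cong₂ _+_ (eq Fin.zero) (sym (prefixSum≡partialSum (f ∘ suc) v (eq ∘ Fin.suc) j≤n))))

  prefixSum-all : ∀ {n} (v : Vec ℕ n) → prefixSum n v ≡ Vec.sum v
  prefixSum-all []      = refl
  prefixSum-all (x ∷ v) = cong (x +_) (prefixSum-all v)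

  module _ (s : ℕ) .{{_ : NonZero s}} where

    Periodic : {A : Set} → (ℕ → A) → Set
    Periodic f = ∀ i → f (i + s) ≡ f i

    periodic-*s : ∀ {A : Set} {f : ℕ → A} → Periodic f → ∀ i k → f (i + k * s) ≡ f i
    periodic-*s {f = f} per i zero    = cong f (+-identityʳ i)
    periodic-*s {f = f} per i (suc k) = trans
      (cong f (trans (cong (i +_) (+-comm s (k * s))) (sym (+-assoc i (k * s) s))))
      (trans (per (i + k * s)) (periodic-*s {f = f} per i k))

    periodic-% : ∀ {A : Set} {f : ℕ → A} → Periodic f → ∀ i → f (i % s) ≡ f i
    periodic-% {f = f} per i = trans (sym (periodic-*s {f = f} per (i % s) (i / s))) (cong f (sym (m≡m%n+[m/n]*n i s)))

    entry : Vec ℕ s → ℕ → ℕ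
    entry v i = lookup v (i mod s)

    toℕ-mod : ∀ i → toℕ (i mod s) ≡ i % s
    toℕ-mod i = toℕ-fromℕ< (m%n<n i s)

    entry-toℕ : ∀ v i → entry v (toℕ i) ≡ lookup v i
    entry-toℕ v i = cong (lookup v) (toℕ-injective (trans (toℕ-mod (toℕ i)) (m<n⇒m%n≡m (toℕ<n i))))

    entry-periodic : ∀ v → Periodic (entry v)
    entry-periodic v i = cong (lookup v) (toℕ-injective
      (trans (toℕ-mod (i + s)) (trans ([m+n]%n≡m%n i s) (sym (toℕ-mod i)))))

    period : (ℕ → ℕ) → Vec ℕ s
    period f = tabulate (f ∘ toℕ)

    entry-period : ∀ {f} → Periodic f → ∀ i → entry (period f) i ≡ f i
    entry-period {f} per i = trans (lookup∘tabulate (f ∘ toℕ) (i mod s)) (trans (cong f (toℕ-mod i)) (periodic-% {f = f} per i))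

    entry-injective : ∀ v w → (∀ i → entry v i ≡ entry w i) → v ≡ w
    entry-injective v w eq = trans (sym (tabulate∘lookup v)) (trans
      (tabulate-cong λ i → trans (sym (entry-toℕ v i)) (trans (eq (toℕ i)) (entry-toℕ w i))) (tabulate∘lookup w))

    height : Vec ℕ s → ℕ → ℕ
    height v = partialSum (entry v)

    prefixSum≡height : ∀ v {j} → j ≤ s → prefixSum j v ≡ height v j
    prefixSum≡height v = prefixSum≡partialSum (entry v) v (entry-toℕ v)

    sum≡height : ∀ v → Vec.sum v ≡ height v s
    sum≡height v = trans (sym (prefixSum-all v)) (prefixSum≡height v ≤-refl)

    height-+s : ∀ v j → height v (j + s) ≡ Vec.sum v + height v j
    height-+s v j = trans (partialSum-+ (entry v) j s)
      (cong₂ _+_ (sym (sum≡height v)) (partialSum-cong (entry-periodic v) j))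

    rotate : ℕ → Vec ℕ s → Vec ℕ s
    rotate k v = period (λ i → entry v (i + k))

    entry-rotate : ∀ k v i → entry (rotate k v) i ≡ entry v (i + k)
    entry-rotate k v = entry-period λ i → trans
      (cong (entry v) (trans (+-assoc i s k) (trans (cong (i +_) (+-comm s k)) (sym (+-assoc i k s)))))
      (entry-periodic v (i + k))

    rotate-inverse : ∀ k l v → k + l ≡ s → rotate k (rotate l v) ≡ v
    rotate-inverse k l v k+l≡s = entry-injective _ v λ i → begin
      entry (rotate k (rotate l v)) i  ≡⟨ entry-rotate k (rotate l v) i ⟩
      entry (rotate l v) (i + k)       ≡⟨ entry-rotate l v (i + k) ⟩
      entry v (i + k + l)              ≡⟨ cong (entry v) (trans (+-assoc i k l) (cong (i +_) k+l≡s)) ⟩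
      entry v (i + s)                  ≡⟨ entry-periodic v i ⟩
      entry v i ∎
      where open ≡-Reasoning

    height-rotate : ∀ k v j → height v k + height (rotate k v) j ≡ height v (j + k)
    height-rotate k v j = trans (cong (height v k +_) (partialSum-cong (entry-rotate k v) j)) (sym (partialSum-+ (entry v) j k))

    sum-rotate : ∀ k v → Vec.sum (rotate k v) ≡ Vec.sum v
    sum-rotate k v = +-cancelˡ-≡ (height v k) _ _ (begin
      height v k + Vec.sum (rotate k v)    ≡⟨ cong (height v k +_) (sum≡height (rotate k v)) ⟩
      height v k + height (rotate k v) s   ≡⟨ height-rotate k v s ⟩
      height v (s + k)                     ≡⟨ cong (height v) (+-comm s k) ⟩
      height v (k + s)                     ≡⟨ height-+s v k ⟩
      Vec.sum v + height v k               ≡⟨ +-comm (Vec.sum v) _ ⟩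
      height v k + Vec.sum v ∎)
      where open ≡-Reasoning

    -- Dyck paths and gap functions

    module _ (t : ℕ) where

      -- The lattice path with column heights v stays below the diagonal.
      Dyck : Vec ℕ s → Set
      Dyck v = ∀ {j} → j < s → s * height v j ≤ j * t

      dyck? : ∀ v → Dec (Dyck v)
      dyck? v = allUpTo? (λ j → s * height v j ≤? j * t) s

      -- The first gap in the class of j t for the bead set belonging to v. For Dyck paths with sum
      -- t the truncated subtraction is exact at every j.
      depth : Vec ℕ s → ℕ → ℕ
      depth v j = j * t ∸ s * height v j

      module _ (v : Vec ℕ s) (sum≡t : Vec.sum v ≡ t) where

        private
          diagonal : ∀ h → s * (t + h) ≡ s * h + s * t
          diagonal h = trans (*-distribˡ-+ s t h) (+-comm (s * t) (s * h))

        s*height-+s : ∀ j → s * height v (j + s) ≡ s * height v j + s * t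
        s*height-+s j = trans (cong (s *_) (trans (height-+s v j) (cong (_+ height v j) sum≡t))) (diagonal (height v j))

        depth-periodic : Periodic (depth v)
        depth-periodic j = trans (cong₂ _∸_ (*-distribʳ-+ t j s) (s*height-+s j))
          ([m+n]∸[o+n]≡m∸o (j * t) (s * height v j) (s * t))
          where
          [m+n]∸[o+n]≡m∸o : ∀ m o n → (m + n) ∸ (o + n) ≡ m ∸ o
          [m+n]∸[o+n]≡m∸o m o n = trans (cong₂ _∸_ (+-comm m n) (+-comm o n)) ([m+n]∸[m+o]≡n∸o n m o)

        module _ (dyck : Dyck v) where

          dyck-all : ∀ j → s * height v j ≤ j * t
          dyck-all j = subst (λ j → s * height v j ≤ j * t) (sym (m≡m%n+[m/n]*n j s)) (go (j / s))
            where
            go : ∀ k → s * height v (j % s + k * s) ≤ (j % s + k * s) * t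
            go zero    = subst (λ j → s * height v j ≤ j * t) (sym (+-identityʳ (j % s))) (dyck (m%n<n j s))
            go (suc k) = subst (λ j → s * height v j ≤ j * t)
              (trans (+-assoc (j % s) (k * s) s) (cong (j % s +_) (+-comm (k * s) s)))
              (subst₂ _≤_ (sym (s*height-+s (j % s + k * s))) (sym (*-distribʳ-+ t (j % s + k * s) s)) (+-monoˡ-≤ (s * t) (go k)))

          depth+ : ∀ j → depth v j + s * height v j ≡ j * t
          depth+ j = m∸n+n≡m (dyck-all j)

          depth-suc : ∀ j → depth v (suc j) ≤ depth v j + t
          depth-suc j = +-cancelʳ-≤ (s * height v j) _ _ (begin
            depth v (suc j) + s * height v j        ≤⟨ +-monoʳ-≤ (depth v (suc j)) (*-monoʳ-≤ s (m≤m+n _ (entry v j))) ⟩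
            depth v (suc j) + s * height v (suc j)  ≡⟨ depth+ (suc j) ⟩
            t + j * t                               ≡⟨ cong (t +_) (depth+ j) ⟨
            t + (depth v j + s * height v j)        ≡⟨ +-assoc t (depth v j) _ ⟨
            t + depth v j + s * height v j          ≡⟨ cong (_+ s * height v j) (+-comm t (depth v j)) ⟩
            depth v j + t + s * height v j          ∎)
            where open ≤-Reasoning

          depth-residue : ∀ j → depth v j % s ≡ (j * t) % s
          depth-residue j = trans (sym ([m+kn]%n≡m%n (depth v j) (height v j) s))
            (cong (_% s) (trans (cong (depth v j +_) (*-comm (height v j) s)) (depth+ j)))

        -- A bound common to all paths, so that all cores can be built with the same cutoff s t.
        depth-≤ : ∀ j → depth v j ≤ s * t
        depth-≤ j = subst (_≤ s * t) (periodic-% {f = depth v} depth-periodic j)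
          (≤-trans (m∸n≤m _ (s * height v (j % s))) (*-monoˡ-≤ t (<⇒≤ (m%n<n j s))))

        depth-cong : ∀ {i j} → i % s ≡ j % s → depth v i ≡ depth v j
        depth-cong {i} {j} eq = trans (sym (periodic-% {f = depth v} depth-periodic i))
          (trans (cong (depth v) eq) (periodic-% {f = depth v} depth-periodic j))

      module _ (u : ℕ) (t*u≡1 : t * u % s ≡ 1 % s) where

        -- Since u inverts t modulo s, x is congruent to (x u) t: the walk is in the class of x at
        -- time x u.
        gapAt : Vec ℕ s → ℕ → ℕ
        gapAt v x = depth v (x * u)

        *u*t : ∀ x → (x * u * t) % s ≡ x % s
        *u*t x = trans (cong (_% s) (trans (*-assoc x u t) (cong (x *_) (*-comm u t))))
          (trans (*-congₛ s {x} {x} {t * u} {1} refl t*u≡1) (cong (_% s) (*-identityʳ x)))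

        *t*u : ∀ x → (x * t * u) % s ≡ x % s
        *t*u x = trans
          (cong (_% s) (trans (*-assoc x t u) (trans (cong (x *_) (*-comm t u)) (sym (*-assoc x u t)))))
          (*u*t x)

        gapAt-isGapFunction : ∀ v → Vec.sum v ≡ t → Dyck v → IsGapFunction s t (gapAt v)
        gapAt-isGapFunction v sum≡t dyck = record
          { residue  = λ x → trans (depth-residue v sum≡t dyck (x * u)) (*u*t x)
          ; periodic = λ {x} {y} eq → depth-cong v sum≡t (*-congₛ s {x} {y} {u} {u} eq refl)
          ; step     = λ x → ≤-trans (≤-reflexive (depth-cong v sum≡t (suc-step x)))
                                     (depth-suc v sum≡t dyck (x * u))
          ; at-zero  = cong (0 ∸_) (*-zeroʳ s)
          }
          where
          suc-step : ∀ x → ((x + t) * u) % s ≡ suc (x * u) % s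
          suc-step x = trans
            (cong (_% s) (trans (*-distribʳ-+ u x t) (+-comm (x * u) (t * u))))
            (+-congₛ s {t * u} {1} {x * u} {x * u} t*u≡1 refl)

        gapAt-injective : ∀ v w → Vec.sum v ≡ t → Dyck v → Vec.sum w ≡ t → Dyck w →
                          (∀ x → gapAt v x ≡ gapAt w x) → v ≡ w
        gapAt-injective v w v-sum v-dyck w-sum w-dyck eq = entry-injective v w λ j →
          +-cancelˡ-≡ (height v j) _ _ (trans (height≡ (suc j)) (cong (_+ entry w j) (sym (height≡ j))))
          where
          depth≡ : ∀ j → depth v j ≡ depth w j
          depth≡ j = trans (sym (depth-cong v v-sum (*t*u j))) (trans (eq (j * t)) (depth-cong w w-sum (*t*u j)))
          height≡ : ∀ j → height v j ≡ height w j
          height≡ j = *-cancelˡ-≡ _ _ s (+-cancelˡ-≡ (depth v j) _ _ (trans (depth+ v v-sum v-dyck j)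
            (trans (sym (depth+ w w-sum w-dyck j)) (cong (_+ s * height w j) (sym (depth≡ j))))))

        -- The entries are forced: F j is z_j, obtained from s z_j = f j + t - f (j + 1).
        -- Telescoping gives `a+height`, which yields the Dyck condition at once, the sum at j = s
        -- because a (s t) = a 0 = 0, and the depths.
        gapAt-surjective : ∀ {a} → IsGapFunction s t a →
                           ∃ λ v → Vec.sum v ≡ t × Dyck v × (∀ x → a x ≡ gapAt v x)
        gapAt-surjective {a} isGap =
          v , sum≡t , (λ {j} _ → ≤-trans (m≤n+m _ (a (j * t))) (≤-reflexive (a+height j)))
            , λ x → trans (periodic isGap (sym (*u*t x))) (sym (depth≡a (x * u)))
          where
          open IsGapFunction
          F : ℕ → ℕ
          F j = (a (j * t) + t ∸ a (j * t + t)) / s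
          F-eq : ∀ j → a (j * t) + t ≡ a (j * t + t) + F j * s
          F-eq j with ≡ₛ-difference s {a (j * t + t)} {a (j * t) + t}
            (trans (residue isGap (j * t + t)) (+-congₛ s {j * t} (sym (residue isGap (j * t))) refl))
            (step isGap (j * t))
          ... | k , eq = trans eq (cong (λ q → a (j * t + t) + q * s) (sym (begin
            (a (j * t) + t ∸ a (j * t + t)) / s            ≡⟨ cong (λ x → (x ∸ a (j * t + t)) / s) eq ⟩
            (a (j * t + t) + k * s ∸ a (j * t + t)) / s    ≡⟨ cong (_/ s) (m+n∸m≡n (a (j * t + t)) (k * s)) ⟩
            k * s / s                                      ≡⟨ m*n/n≡m k s ⟩
            k ∎)))
            where open ≡-Reasoning
          shift : ∀ j d → (j + s) * t + d ≡ j * t + d + t * s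
          shift j d = lemma s t j d
            where
            lemma : ∀ s t j d → (j + s) * t + d ≡ j * t + d + t * s
            lemma = solve-∀
          shift% : ∀ j d → ((j + s) * t + d) % s ≡ (j * t + d) % s
          shift% j d = trans (cong (_% s) (shift j d)) ([m+kn]%n≡m%n (j * t + d) t s)
          F-periodic : Periodic F
          F-periodic j = cong₂ (λ x y → (x + t ∸ y) / s)
            (periodic isGap (subst₂ (λ x y → x % s ≡ y % s) (+-identityʳ _) (+-identityʳ _) (shift% j 0)))
            (periodic isGap (shift% j t))
          v : Vec ℕ s
          v = period F
          a+height : ∀ j → a (j * t) + s * height v j ≡ j * t
          a+height zero    = trans (cong₂ _+_ (at-zero isGap) (*-zeroʳ s)) refl
          a+height (suc j) = begin
            a (t + j * t) + s * (height v j + entry v j)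
              ≡⟨ cong₂ (λ x y → a x + s * (height v j + y)) (+-comm t (j * t)) (entry-period {F} F-periodic j) ⟩
            a (j * t + t) + s * (height v j + F j)
              ≡⟨ rearrange (a (j * t + t)) s (height v j) (F j) ⟩
            a (j * t + t) + F j * s + s * height v j
              ≡⟨ cong (_+ s * height v j) (F-eq j) ⟨
            a (j * t) + t + s * height v j
              ≡⟨ rotate₃ (a (j * t)) t _ ⟩
            t + (a (j * t) + s * height v j)
              ≡⟨ cong (t +_) (a+height j) ⟩
            t + j * t ∎
            where
            open ≡-Reasoning
            rearrange : ∀ x s h f → x + s * (h + f) ≡ x + f * s + s * h
            rearrange = solve-∀
            rotate₃ : ∀ x y z → x + y + z ≡ y + (x + z)
            rotate₃ = solve-∀
          sum≡t : Vec.sum v ≡ t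
          sum≡t = *-cancelˡ-≡ _ _ s (trans (cong (s *_) (sum≡height v))
            (trans (cong (_+ s * height v s) (sym a-st≡0)) (a+height s)))
            where
            a-st≡0 : a (s * t) ≡ 0
            a-st≡0 = trans (periodic isGap {s * t} {0}
              (trans (cong (_% s) (*-comm s t)) (trans (m*n%n≡0 t s) (sym (m*n%n≡0 0 s))))) (at-zero isGap)
          depth≡a : ∀ j → depth v j ≡ a (j * t)
          depth≡a j = trans (cong (_∸ s * height v j) (sym (a+height j))) (m+n∸n≡m _ (s * height v j))

open import Data.Integer using (ℤ; +_; _+_; _-_; _*_; 0ℤ; 1ℤ; _≤_; +≤+)
import Data.Integer.Properties as ℤ
open import Data.Integer.Tactic.RingSolver using (solve-∀)
open import Data.List.Extrema ℤ.≤-totalOrder using (argmin; f[argmin]≤f[xs]; argmin-all)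
open import Data.Rational using (_/_)
import Data.Rational.Properties as ℚ
open import Data.Rational.Unnormalised using (mkℚᵘ; *≡*)

-- Finite sums of integers

private variable
  A B : Set

⅀ : List A → (A → ℤ) → ℤ
⅀ []       f = 0ℤ
⅀ (x ∷ xs) f = f x + ⅀ xs f

𝟙 : {P : Set} → Dec P → ℤ
𝟙 (yes _) = 1ℤ
𝟙 (no _)  = 0ℤ

⅀-cong : ∀ (xs : List A) {f g : A → ℤ} → (∀ {x} → x ∈ₗ xs → f x ≡ g x) → ⅀ xs f ≡ ⅀ xs g
⅀-cong []       eq = refl
⅀-cong (x ∷ xs) eq = cong₂ _+_ (eq (here refl)) (⅀-cong xs (eq ∘ there))

⅀-0 : ∀ (xs : List A) → ⅀ xs (λ _ → 0ℤ) ≡ 0ℤ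
⅀-0 []       = refl
⅀-0 (x ∷ xs) = trans (ℤ.+-identityˡ _) (⅀-0 xs)

⅀-+ : ∀ (xs : List A) f g → ⅀ xs (λ x → f x + g x) ≡ ⅀ xs f + ⅀ xs g
⅀-+ []       f g = refl
⅀-+ (x ∷ xs) f g = trans (cong (λ z → f x + g x + z) (⅀-+ xs f g)) (interchange (f x) (g x) _ _)
  where
  interchange : ∀ a b c d → a + b + (c + d) ≡ a + c + (b + d)
  interchange = solve-∀

⅀-*ˡ : ∀ (xs : List A) c f → ⅀ xs (λ x → c * f x) ≡ c * ⅀ xs f
⅀-*ˡ []       c f = sym (ℤ.*-zeroʳ c)
⅀-*ˡ (x ∷ xs) c f = trans (cong (λ z → c * f x + z) (⅀-*ˡ xs c f)) (sym (ℤ.*-distribˡ-+ c (f x) _))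

⅀-minus : ∀ (xs : List A) f g → ⅀ xs (λ x → f x - g x) ≡ ⅀ xs f - ⅀ xs g
⅀-minus []       f g = refl
⅀-minus (x ∷ xs) f g = trans (cong (λ z → f x - g x + z) (⅀-minus xs f g)) (interchange (f x) (g x) _ _)
  where
  interchange : ∀ a b c d → a - b + (c - d) ≡ a + c - (b + d)
  interchange = solve-∀

⅀-const : ∀ (xs : List A) c → ⅀ xs (λ _ → c) ≡ + length xs * c
⅀-const []       c = sym (ℤ.*-zeroˡ c)
⅀-const (x ∷ xs) c = trans (cong (λ z → c + z) (⅀-const xs c)) (sym (ℤ.suc-* (+ length xs) c))

⅀-comm : ∀ (xs : List A) (ys : List B) (f : A → B → ℤ) →
         ⅀ xs (λ x → ⅀ ys (f x)) ≡ ⅀ ys (λ y → ⅀ xs (λ x → f x y))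
⅀-comm []       ys f = sym (⅀-0 ys)
⅀-comm (x ∷ xs) ys f = trans (cong (λ z → ⅀ ys (f x) + z) (⅀-comm xs ys f)) (sym (⅀-+ ys (f x) _))

⅀-map : ∀ (f : A → B) xs g → ⅀ (map f xs) g ≡ ⅀ xs (g ∘ f)
⅀-map f []       g = refl
⅀-map f (x ∷ xs) g = cong (λ z → g (f x) + z) (⅀-map f xs g)

⅀-++ : ∀ (xs ys : List A) f → ⅀ (xs ++ ys) f ≡ ⅀ xs f + ⅀ ys f
⅀-++ []       ys f = sym (ℤ.+-identityˡ _)
⅀-++ (x ∷ xs) ys f = trans (cong (λ z → f x + z) (⅀-++ xs ys f)) (sym (ℤ.+-assoc (f x) _ _))

⅀-filter : ∀ {P : Pred A 0ℓ} (P? : Decidable P) xs f →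
           ⅀ (filter P? xs) f ≡ ⅀ xs (λ x → 𝟙 (P? x) * f x)
⅀-filter P? []       f = refl
⅀-filter P? (x ∷ xs) f with P? x
... | yes p = cong₂ _+_ (sym (ℤ.*-identityˡ (f x))) (⅀-filter P? xs f)
... | no ¬p = trans (⅀-filter P? xs f) (sym (ℤ.+-identityˡ _))

⅀-↭ : ∀ {xs ys : List A} → xs ↭ ys → ∀ f → ⅀ xs f ≡ ⅀ ys f
⅀-↭ ↭.refl          f = refl
⅀-↭ (↭.prep x p)    f = cong (λ z → f x + z) (⅀-↭ p f)
⅀-↭ (↭.swap x y p)  f = trans (cong (λ z → f x + (f y + z)) (⅀-↭ p f)) (exchange (f x) (f y) _)
  where
  exchange : ∀ a b c → a + (b + c) ≡ b + (a + c)
  exchange = solve-∀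
⅀-↭ (↭.trans p q)   f = trans (⅀-↭ p f) (⅀-↭ q f)

⅀-sum : ∀ (xs : List A) f → + sum (map f xs) ≡ ⅀ xs (λ x → + f x)
⅀-sum []       f = refl
⅀-sum (x ∷ xs) f = cong (λ z → + f x + z) (⅀-sum xs f)

AllPairs-map-on : ∀ {P : Pred A 0ℓ} {R S : A → A → Set} {xs} →
  (∀ {x y} → P x → P y → R x y → S x y) → All P xs → AllPairs R xs → AllPairs S xs
AllPairs-map-on f []         []         = []
AllPairs-map-on f (px ∷ pxs) (rx ∷ rxs) =
  All.zipWith (λ (py , r) → f px py r) (pxs , rx) ∷ AllPairs-map-on f pxs rxs

-- `map φ xs` and `ys` are duplicate-free with the same members, hence permutations of each other.
⅀-bijection : ∀ {xs : List A} {ys : List B} (φ : A → B) (ψ : B → A) → Unique xs → Unique ys →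
  (∀ {x} → x ∈ₗ xs → φ x ∈ₗ ys) → (∀ {y} → y ∈ₗ ys → ψ y ∈ₗ xs) →
  (∀ {x} → x ∈ₗ xs → ψ (φ x) ≡ x) → (∀ {y} → y ∈ₗ ys → φ (ψ y) ≡ y) →
  ∀ f → ⅀ ys f ≡ ⅀ xs (f ∘ φ)
⅀-bijection {xs = xs} {ys} φ ψ uxs uys φ∈ ψ∈ ψφ φψ f =
  trans (⅀-↭ (∼bag⇒↭ (unique∧set⇒bag uys unique-image (mk⇔ to from))) f) (⅀-map φ xs f)
  where
  unique-image : Unique (map φ xs)
  unique-image = AllPairs.map⁺ (AllPairs-map-on
    (λ x∈ y∈ x≢y eq → x≢y (trans (sym (ψφ x∈)) (trans (cong ψ eq) (ψφ y∈))))
    (All.tabulate (λ x∈ → x∈)) uxs)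
  to : ∀ {y} → y ∈ₗ ys → y ∈ₗ map φ xs
  to y∈ = subst (_∈ₗ map φ xs) (φψ y∈) (∈-map⁺ φ (ψ∈ y∈))
  from : ∀ {y} → y ∈ₗ map φ xs → y ∈ₗ ys
  from y∈ with x , x∈ , refl ← ∈-map⁻ φ y∈ = φ∈ x∈

range-split : ∀ m n f → ⅀ (downFrom (m ℕ.+ n)) f ≡ ⅀ (downFrom n) f + ⅀ (downFrom m) (λ i → f (i ℕ.+ n))
range-split zero    n f = sym (ℤ.+-identityʳ _)
range-split (suc m) n f = trans (cong (λ z → f (m ℕ.+ n) + z) (range-split m n f)) (exchange (f (m ℕ.+ n)) (⅀ (downFrom n) f) _)
  where
  exchange : ∀ a b c → a + (b + c) ≡ b + (a + c)
  exchange = solve-∀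

-- The sum of f below m + n is split once at n and once at m. It serves both to telescope over beads
-- and to shift a period.
range-shift : ∀ m n f → ⅀ (downFrom n) f - ⅀ (downFrom n) (λ i → f (i ℕ.+ m))
                      ≡ ⅀ (downFrom m) f - ⅀ (downFrom m) (λ i → f (i ℕ.+ n))
range-shift m n f = rearrange (⅀ (downFrom n) f) _ (⅀ (downFrom m) f) _ (begin
  ⅀ (downFrom n) f + ⅀ (downFrom m) (λ i → f (i ℕ.+ n))  ≡⟨ range-split m n f ⟨
  ⅀ (downFrom (m ℕ.+ n)) f                              ≡⟨ cong (λ k → ⅀ (downFrom k) f) (ℕ.+-comm m n) ⟩
  ⅀ (downFrom (n ℕ.+ m)) f                              ≡⟨ range-split n m f ⟩
  ⅀ (downFrom m) f + ⅀ (downFrom n) (λ i → f (i ℕ.+ m))  ∎)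
  where
  open ≡-Reasoning
  rearrange : ∀ a b c d → a + d ≡ c + b → a - b ≡ c - d
  rearrange a b c d eq = trans (move₁ a b d) (trans (cong (_- (b + d)) eq) (move₂ b c d))
    where
    move₁ : ∀ a b d → a - b ≡ a + d - (b + d)
    move₁ = solve-∀
    move₂ : ∀ b c d → c + b - (b + d) ≡ c - d
    move₂ = solve-∀

⅀-𝟙-unique : ∀ {P : Pred A 0ℓ} (P? : Decidable P) {xs x} → Unique xs → x ∈ₗ xs → P x →
             (∀ {y} → y ∈ₗ xs → P y → y ≡ x) → ⅀ xs (λ y → 𝟙 (P? y)) ≡ 1ℤ
⅀-𝟙-unique P? {z ∷ zs} {x} u@(z∉ ∷ uzs) x∈ px only with P? z
... | yes pz with refl ← only (here refl) pz = cong (λ z → 1ℤ + z) (trans (⅀-cong zs none) (⅀-0 zs))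
  where
  none : ∀ {y} → y ∈ₗ zs → 𝟙 (P? y) ≡ 0ℤ
  none {y} y∈ with P? y
  ... | yes py = contradiction (sym (only (there y∈) py)) (All.lookup z∉ y∈)
  ... | no _   = refl
⅀-𝟙-unique P? {z ∷ zs} {x} (z∉ ∷ uzs) (here refl) px only | no ¬pz = contradiction px ¬pz
⅀-𝟙-unique P? {z ∷ zs} {x} (z∉ ∷ uzs) (there x∈)  px only | no ¬pz =
  trans (ℤ.+-identityˡ _) (⅀-𝟙-unique P? uzs x∈ px (only ∘ there))

-- Moments of prefix sums of compositions

incHead : ∀ {n} → Vec ℕ (suc n) → Vec ℕ (suc n)
incHead (x ∷ xs) = suc x ∷ xs

-- Zero parts are allowed. Separating head 0 from positive head gives Pascal's recursion, along
-- which all moments are computed.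
compositions : ∀ s → ℕ → List (Vec ℕ s)
compositions zero    zero    = [] ∷ []
compositions zero    (suc t) = []
compositions (suc s) zero    = map (0 ∷_) (compositions s zero)
compositions (suc s) (suc t) = map (0 ∷_) (compositions s (suc t)) ++ map incHead (compositions (suc s) t)

∈-compositions⁺ : ∀ {s} t (v : Vec ℕ s) → Vec.sum v ≡ t → v ∈ₗ compositions s t
∈-compositions⁺ zero    []            refl = here refl
∈-compositions⁺ zero    (zero ∷ v)    eq   = ∈-map⁺ (0 ∷_) (∈-compositions⁺ 0 v eq)
∈-compositions⁺ (suc t) (zero ∷ v)    eq   = ∈-++⁺ˡ (∈-map⁺ (0 ∷_) (∈-compositions⁺ (suc t) v eq))
∈-compositions⁺ (suc t) (suc x ∷ v)   eq   =
  ∈-++⁺ʳ _ (∈-map⁺ incHead (∈-compositions⁺ t (x ∷ v) (ℕ.suc-injective eq)))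

∈-compositions⁻ : ∀ s t {v : Vec ℕ s} → v ∈ₗ compositions s t → Vec.sum v ≡ t
∈-compositions⁻ zero    zero    (here refl) = refl
∈-compositions⁻ (suc s) zero    v∈ with ∈-map⁻ (0 ∷_) v∈
... | w , w∈ , refl = ∈-compositions⁻ s 0 w∈
∈-compositions⁻ (suc s) (suc t) v∈ with ∈-++⁻ (map (0 ∷_) (compositions s (suc t))) v∈
... | inj₁ v∈₁ with w , w∈ , refl ← ∈-map⁻ (0 ∷_) v∈₁ = ∈-compositions⁻ s (suc t) w∈
... | inj₂ v∈₂ with x ∷ w , w∈ , refl ← ∈-map⁻ incHead v∈₂ = cong suc (∈-compositions⁻ (suc s) t w∈)

compositions-unique : ∀ s t → Unique (compositions s t)
compositions-unique zero    zero    = [] ∷ []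
compositions-unique zero    (suc t) = []
compositions-unique (suc s) zero    = Unique.map⁺ (λ { refl → refl }) (compositions-unique s 0)
compositions-unique (suc s) (suc t) = Unique.++⁺
  (Unique.map⁺ (λ { refl → refl }) (compositions-unique s (suc t)))
  (Unique.map⁺ (λ { {_ ∷ _} {_ ∷ _} refl → refl }) (compositions-unique (suc s) t))
  disjoint
  where
  disjoint : ∀ {v} → ¬ (v ∈ₗ map (0 ∷_) (compositions s (suc t)) × v ∈ₗ map incHead (compositions (suc s) t))
  disjoint (v∈₁ , v∈₂) with ∈-map⁻ (0 ∷_) v∈₁ | ∈-map⁻ incHead v∈₂
  ... | _ , _ , refl | _ ∷ _ , _ , ()

⅀-compositions : ∀ s t f → ⅀ (compositions (suc s) (suc t)) f
  ≡ ⅀ (compositions s (suc t)) (f ∘ (0 ∷_)) + ⅀ (compositions (suc s) t) (f ∘ incHead)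
⅀-compositions s t f = trans (⅀-++ (map (0 ∷_) (compositions s (suc t))) _ f)
  (cong₂ _+_ (⅀-map (0 ∷_) (compositions s (suc t)) f) (⅀-map incHead (compositions (suc s) t) f))

-- N₀ s t, N₁ s t and N₂ s t are the binomial-type numbers C(s,t), C(s+1,t-1)
-- and C(s+2,t-2), where C(s,t) counts the compositions of t into s parts.
N₀ N₁ N₂ : ℕ → ℕ → ℤ
N₀ s t       = ⅀ (compositions s t) (λ _ → 1ℤ)
N₁ s zero    = 0ℤ
N₁ s (suc t) = N₀ (suc s) t
N₂ s zero    = 0ℤ
N₂ s (suc t) = N₁ (suc s) t

N₀-0 : ∀ s → N₀ s 0 ≡ 1ℤ
N₀-0 zero    = refl
N₀-0 (suc s) = trans (⅀-map (0 ∷_) (compositions s 0) _) (N₀-0 s)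

N₀-pascal : ∀ s t → N₀ (suc s) (suc t) ≡ N₀ s (suc t) + N₀ (suc s) t
N₀-pascal s t = ⅀-compositions s t (λ _ → 1ℤ)

N₁-pascal : ∀ s t → N₁ (suc s) (suc t) ≡ N₁ s (suc t) + N₁ (suc s) t
N₁-pascal s zero    = trans (N₀-0 (2 ℕ.+ s)) (trans (sym (N₀-0 (suc s))) (sym (ℤ.+-identityʳ _)))
N₁-pascal s (suc t) = N₀-pascal (suc s) t

N₂-pascal : ∀ s t → N₂ (suc s) (suc t) ≡ N₂ s (suc t) + N₂ (suc s) t
N₂-pascal s zero    = refl
N₂-pascal s (suc t) = N₁-pascal (suc s) t

-- For s ≥ 1 this is t binom(s+t-1, t) = s binom(s+t-1, t-1), proved along Pascal's recursion
-- without division.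
absorption₁ : ∀ s t → + t * N₀ s t ≡ + s * N₁ s t
absorption₁ s       zero    = trans (ℤ.*-zeroˡ (N₀ s 0)) (sym (ℤ.*-zeroʳ (+ s)))
absorption₁ zero    (suc t) = trans (ℤ.*-zeroʳ (+ suc t)) (sym (ℤ.*-zeroˡ (N₀ 1 t)))
absorption₁ (suc s) (suc t) = begin
  + suc t * N₀ (suc s) (suc t)
    ≡⟨ cong (+ suc t *_) (N₀-pascal s t) ⟩
  (1ℤ + + t) * (N₀ s (suc t) + N₀ (suc s) t)
    ≡⟨ expand (+ t) (N₀ s (suc t)) (N₀ (suc s) t) ⟩
  (1ℤ + + t) * N₀ s (suc t) + (N₀ (suc s) t + + t * N₀ (suc s) t)
    ≡⟨ cong₂ (λ x y → x + (N₀ (suc s) t + y)) (absorption₁ s (suc t)) (absorption₁ (suc s) t) ⟩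
  + s * N₀ (suc s) t + (N₀ (suc s) t + (1ℤ + + s) * N₁ (suc s) t)
    ≡⟨ collect (+ s) (N₀ (suc s) t) (N₁ (suc s) t) ⟩
  (1ℤ + + s) * (N₁ s (suc t) + N₁ (suc s) t)
    ≡⟨ cong (+ suc s *_) (N₁-pascal s t) ⟨
  + suc s * N₁ (suc s) (suc t) ∎
  where
  open ≡-Reasoning
  expand : ∀ t a b → (1ℤ + t) * (a + b) ≡ (1ℤ + t) * a + (b + t * b)
  expand = solve-∀
  collect : ∀ s a b → s * a + (a + (1ℤ + s) * b) ≡ (1ℤ + s) * (a + b)
  collect = solve-∀

-- `absorption₁` applied at (s, t) and then at (s + 1, t - 1).
absorption₂ : ∀ s t → + t * (+ t - 1ℤ) * N₀ s t ≡ + s * (+ s + 1ℤ) * N₂ s t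
absorption₂ s zero    = sym (ℤ.*-zeroʳ (+ s * (+ s + 1ℤ)))
absorption₂ s (suc t) = begin
  + suc t * (1ℤ + + t - 1ℤ) * N₀ s (suc t)  ≡⟨ regroup₁ (+ suc t) (+ t) (N₀ s (suc t)) ⟩
  + t * (+ suc t * N₀ s (suc t))           ≡⟨ cong (+ t *_) (absorption₁ s (suc t)) ⟩
  + t * (+ s * N₀ (suc s) t)               ≡⟨ regroup₂ (+ t) (+ s) (N₀ (suc s) t) ⟩
  + s * (+ t * N₀ (suc s) t)               ≡⟨ cong (+ s *_) (absorption₁ (suc s) t) ⟩
  + s * ((1ℤ + + s) * N₁ (suc s) t)        ≡⟨ regroup₃ (+ s) (N₁ (suc s) t) ⟩
  + s * (+ s + 1ℤ) * N₁ (suc s) t          ∎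
  where
  open ≡-Reasoning
  regroup₁ : ∀ u t a → u * (1ℤ + t - 1ℤ) * a ≡ t * (u * a)
  regroup₁ = solve-∀
  regroup₂ : ∀ t s a → t * (s * a) ≡ s * (t * a)
  regroup₂ = solve-∀
  regroup₃ : ∀ s a → s * ((1ℤ + s) * a) ≡ s * (s + 1ℤ) * a
  regroup₃ = solve-∀

-- Marking a unit in a given part splits that part in two and leaves a composition of t - 1 into s +
-- 1 parts; there are j parts to choose from. In the induction, a head 0 shortens the prefix and
-- `incHead` raises its sum by one.
moment₁ : ∀ {s} t {j} → j ℕ.≤ s → ⅀ (compositions s t) (λ v → + prefixSum j v) ≡ + j * N₁ s t
moment₁ {s}     t       {zero}  _         = trans (⅀-0 (compositions s t)) (sym (ℤ.*-zeroˡ (N₁ s t)))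
moment₁ {suc s} zero    {suc j} (s≤s j≤s) = begin
  ⅀ (map (0 ∷_) (compositions s 0)) (λ v → + prefixSum (suc j) v)  ≡⟨ ⅀-map (0 ∷_) (compositions s 0) _ ⟩
  ⅀ (compositions s 0) (λ v → + prefixSum j v)                     ≡⟨ moment₁ 0 j≤s ⟩
  + j * 0ℤ                                                        ≡⟨ ℤ.*-zeroʳ (+ j) ⟩
  0ℤ                                                              ≡⟨ ℤ.*-zeroʳ (+ suc j) ⟨
  + suc j * 0ℤ ∎
  where open ≡-Reasoning
moment₁ {suc s} (suc t) {suc j} (s≤s j≤s) = begin
  ⅀ (compositions (suc s) (suc t)) (λ v → + prefixSum (suc j) v)
    ≡⟨ ⅀-compositions s t _ ⟩
  ⅀ (compositions s (suc t)) (λ v → + prefixSum j v) + ⅀ (compositions (suc s) t) (λ v → + prefixSum (suc j) (incHead v))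
    ≡⟨ cong₂ _+_ (moment₁ (suc t) j≤s)
        (trans (⅀-cong (compositions (suc s) t) λ { {x ∷ v} _ → refl })
        (trans (⅀-+ (compositions (suc s) t) (λ _ → 1ℤ) _)
               (cong (λ z → N₀ (suc s) t + z) (moment₁ t (s≤s j≤s))))) ⟩
  + j * N₀ (suc s) t + (N₀ (suc s) t + (1ℤ + + j) * N₁ (suc s) t)
    ≡⟨ collect (+ j) (N₀ (suc s) t) (N₁ (suc s) t) ⟩
  (1ℤ + + j) * (N₁ s (suc t) + N₁ (suc s) t)
    ≡⟨ cong (+ suc j *_) (N₁-pascal s t) ⟨
  + suc j * N₁ (suc s) (suc t) ∎
  where
  open ≡-Reasoning
  collect : ∀ j a b → j * a + (a + (1ℤ + j) * b) ≡ (1ℤ + j) * (a + b)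
  collect = solve-∀

-- The factorial moment counts ordered pairs of distinct units in the first j parts: j (j + 1) / 2
-- choices of the parts holding them, two orders, and each choice leaves a composition of t - 2 into
-- s + 2 parts.
moment₂ : ∀ {s} t {j} → j ℕ.≤ s →
  ⅀ (compositions s t) (λ v → + prefixSum j v * (+ prefixSum j v - 1ℤ)) ≡ + j * (+ j + 1ℤ) * N₂ s t
moment₂ {s}     t       {zero}  _         = trans (⅀-0 (compositions s t)) (sym (ℤ.*-zeroˡ (N₂ s t)))
moment₂ {suc s} zero    {suc j} (s≤s j≤s) = begin
  ⅀ (map (0 ∷_) (compositions s 0)) _  ≡⟨ ⅀-map (0 ∷_) (compositions s 0) _ ⟩
  ⅀ (compositions s 0) _               ≡⟨ moment₂ 0 j≤s ⟩
  + j * (+ j + 1ℤ) * 0ℤ                ≡⟨ ℤ.*-zeroʳ (+ j * (+ j + 1ℤ)) ⟩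
  0ℤ                                   ≡⟨ ℤ.*-zeroʳ (+ suc j * (+ suc j + 1ℤ)) ⟨
  + suc j * (+ suc j + 1ℤ) * 0ℤ ∎
  where open ≡-Reasoning
moment₂ {suc s} (suc t) {suc j} (s≤s j≤s) = begin
  ⅀ (compositions (suc s) (suc t)) _
    ≡⟨ ⅀-compositions s t _ ⟩
  ⅀ (compositions s (suc t)) (λ v → + prefixSum j v * (+ prefixSum j v - 1ℤ)) + ⅀ (compositions (suc s) t) _
    ≡⟨ cong₂ _+_ (moment₂ (suc t) j≤s)
        (trans (⅀-cong (compositions (suc s) t) λ { {x ∷ v} _ → shift (+ prefixSum (suc j) (x ∷ v)) })
        (trans (⅀-+ (compositions (suc s) t) (λ v → + 2 * + prefixSum (suc j) v) _)
               (cong₂ _+_ (trans (⅀-*ˡ (compositions (suc s) t) (+ 2) _) (cong (+ 2 *_) (moment₁ t (s≤s j≤s))))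
                          (moment₂ t (s≤s j≤s))))) ⟩
  + j * (+ j + 1ℤ) * N₁ (suc s) t + (+ 2 * ((1ℤ + + j) * N₁ (suc s) t) + (1ℤ + + j) * (1ℤ + + j + 1ℤ) * N₂ (suc s) t)
    ≡⟨ collect (+ j) (N₁ (suc s) t) (N₂ (suc s) t) ⟩
  (1ℤ + + j) * (1ℤ + + j + 1ℤ) * (N₂ s (suc t) + N₂ (suc s) t)
    ≡⟨ cong (+ suc j * (+ suc j + 1ℤ) *_) (N₂-pascal s t) ⟨
  + suc j * (+ suc j + 1ℤ) * N₂ (suc s) (suc t) ∎
  where
  open ≡-Reasoning
  shift : ∀ x → (1ℤ + x) * (1ℤ + x - 1ℤ) ≡ + 2 * x + x * (x - 1ℤ)
  shift = solve-∀
  collect : ∀ j a b → j * (j + 1ℤ) * a + (+ 2 * ((1ℤ + j) * a) + (1ℤ + j) * (1ℤ + j + 1ℤ) * b)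
                      ≡ (1ℤ + j) * (1ℤ + j + 1ℤ) * (a + b)
  collect = solve-∀

-- Second moment of the walk over all compositions

sq : ℤ → ℤ
sq x = x * x

-- The factor s + 1 lets `absorption₂` turn N₂ into N₀ without division; together with
-- `absorption₁`, only N₀ remains.
variance : ∀ s t {j} → j ℕ.≤ s →
  (+ s + 1ℤ) * ⅀ (compositions s t) (λ v → sq (+ j * + t - + s * + prefixSum j v))
    ≡ + t * (+ s + + t) * N₀ s t * (+ j * (+ s - + j))
variance s t {j} j≤s = begin
  (+ s + 1ℤ) * ⅀ (compositions s t) (λ v → sq (+ j * + t - + s * + prefixSum j v))
    ≡⟨ cong ((+ s + 1ℤ) *_) (trans (⅀-cong (compositions s t) λ {v} _ → expand (+ s) (+ t) (+ j) (+ prefixSum j v))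
       (trans (⅀-+ (compositions s t) _ _) (cong₂ _+_ 
         (trans (⅀-+ (compositions s t) _ _) (cong₂ _+_ (⅀-*ˡ (compositions s t) (sq (+ j * + t)) _)
            (⅀-*ˡ (compositions s t) (+ s * + s - + 2 * + j * + t * + s) _)))
         (⅀-*ˡ (compositions s t) (+ s * + s) _)))) ⟩
  (+ s + 1ℤ) * (sq (+ j * + t) * N₀ s t
    + (+ s * + s - + 2 * + j * + t * + s) * ⅀ (compositions s t) (λ v → + prefixSum j v)
    + + s * + s * ⅀ (compositions s t) (λ v → + prefixSum j v * (+ prefixSum j v - 1ℤ)))
    ≡⟨ cong₂ (λ x y → (+ s + 1ℤ) * (sq (+ j * + t) * N₀ s t + (+ s * + s - + 2 * + j * + t * + s) * x + + s * + s * y))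
         (moment₁ t j≤s) (moment₂ t j≤s) ⟩
  (+ s + 1ℤ) * (sq (+ j * + t) * N₀ s t
    + (+ s * + s - + 2 * + j * + t * + s) * (+ j * N₁ s t) + + s * + s * (+ j * (+ j + 1ℤ) * N₂ s t))
    ≡⟨ regroup (+ s) (+ t) (+ j) (N₀ s t) (N₁ s t) (N₂ s t) ⟩
  (+ s + 1ℤ) * (sq (+ j * + t) * N₀ s t + (+ s - + 2 * + j * + t) * + j * (+ s * N₁ s t))
    + + s * (+ j * (+ j + 1ℤ)) * (+ s * (+ s + 1ℤ) * N₂ s t)
    ≡⟨ cong₂ (λ x y → (+ s + 1ℤ) * (sq (+ j * + t) * N₀ s t + (+ s - + 2 * + j * + t) * + j * x) + + s * (+ j * (+ j + 1ℤ)) * y)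
         (absorption₁ s t) (absorption₂ s t) ⟨
  (+ s + 1ℤ) * (sq (+ j * + t) * N₀ s t + (+ s - + 2 * + j * + t) * + j * (+ t * N₀ s t))
    + + s * (+ j * (+ j + 1ℤ)) * (+ t * (+ t - 1ℤ) * N₀ s t)
    ≡⟨ collect (+ s) (+ t) (+ j) (N₀ s t) ⟩
  + t * (+ s + + t) * N₀ s t * (+ j * (+ s - + j)) ∎
  where
  open ≡-Reasoning
  expand : ∀ s t j x → (j * t - s * x) * (j * t - s * x) ≡
    (j * t) * (j * t) * 1ℤ + (s * s - + 2 * j * t * s) * x + s * s * (x * (x - 1ℤ))
  expand = solve-∀
  regroup : ∀ s t j a b c →
    (s + 1ℤ) * ((j * t) * (j * t) * a + (s * s - + 2 * j * t * s) * (j * b) + s * s * (j * (j + 1ℤ) * c))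
    ≡ (s + 1ℤ) * ((j * t) * (j * t) * a + (s - + 2 * j * t) * j * (s * b)) + s * (j * (j + 1ℤ)) * (s * (s + 1ℤ) * c)
  regroup = solve-∀
  collect : ∀ s t j a →
    (s + 1ℤ) * ((j * t) * (j * t) * a + (s - + 2 * j * t) * j * (t * a)) + s * (j * (j + 1ℤ)) * (t * (t - 1ℤ) * a)
    ≡ t * (s + t) * a * (j * (s - j))
  collect = solve-∀

sum-squares : ∀ s t →
  + 6 * ⅀ (compositions s t) (λ v → ⅀ (downFrom s) (λ j → sq (+ j * + t - + s * + prefixSum j v)))
    ≡ + t * (+ s + + t) * (+ s * (+ s - 1ℤ)) * N₀ s t
sum-squares s t = ℤ.*-cancelˡ-≡ (+ suc s) _ _ (begin
  + suc s * (+ 6 * ⅀ (compositions s t) (λ v → ⅀ (downFrom s) (λ j → f j v)))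
    ≡⟨ cong (λ x → + suc s * (+ 6 * x)) (⅀-comm (compositions s t) (downFrom s) (λ v j → f j v)) ⟩
  + suc s * (+ 6 * ⅀ (downFrom s) (λ j → ⅀ (compositions s t) (f j)))
    ≡⟨ rearrange (+ s) _ ⟩
  + 6 * ((+ s + 1ℤ) * ⅀ (downFrom s) (λ j → ⅀ (compositions s t) (f j)))
    ≡⟨ cong (+ 6 *_) (⅀-*ˡ (downFrom s) (+ s + 1ℤ) _) ⟨
  + 6 * ⅀ (downFrom s) (λ j → (+ s + 1ℤ) * ⅀ (compositions s t) (f j))
    ≡⟨ cong (+ 6 *_) (⅀-cong (downFrom s) λ {j} j∈ → variance s t (ℕ.<⇒≤ (∈-downFrom⁻ j∈))) ⟩
  + 6 * ⅀ (downFrom s) (λ j → + t * (+ s + + t) * N₀ s t * (+ j * (+ s - + j)))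
    ≡⟨ cong (+ 6 *_) (⅀-*ˡ (downFrom s) (+ t * (+ s + + t) * N₀ s t) _) ⟩
  + 6 * (+ t * (+ s + + t) * N₀ s t * ⅀ (downFrom s) (λ j → + j * (+ s - + j)))
    ≡⟨ exchange (+ 6) (+ t * (+ s + + t) * N₀ s t) _ ⟩
  + t * (+ s + + t) * N₀ s t * (+ 6 * ⅀ (downFrom s) (λ j → + j * (+ s - + j)))
    ≡⟨ cong (+ t * (+ s + + t) * N₀ s t *_) (closed s) ⟩
  + t * (+ s + + t) * N₀ s t * (+ s * (+ s - 1ℤ) * (+ 3 * + s - + 2 * + s + 1ℤ))
    ≡⟨ collect (+ s) (+ t) (N₀ s t) ⟩
  + suc s * (+ t * (+ s + + t) * (+ s * (+ s - 1ℤ)) * N₀ s t) ∎)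
  where
  open ≡-Reasoning
  open import Data.List.Membership.Propositional.Properties using (∈-downFrom⁻)
  f : ℕ → Vec ℕ s → ℤ
  f j v = sq (+ j * + t - + s * + prefixSum j v)
  rearrange : ∀ s x → (1ℤ + s) * (+ 6 * x) ≡ + 6 * ((s + 1ℤ) * x)
  rearrange = solve-∀
  exchange : ∀ a b c → a * (b * c) ≡ b * (a * c)
  exchange = solve-∀
  collect : ∀ s t a → t * (s + t) * a * (s * (s - 1ℤ) * (+ 3 * s - + 2 * s + 1ℤ))
                    ≡ (1ℤ + s) * (t * (s + t) * (s * (s - 1ℤ)) * a)
  collect = solve-∀
  step : ∀ m n x → + 6 * (n * (m - n) + x) ≡ + 6 * (n * (m - n)) + + 6 * x
  step = solve-∀
  finish : ∀ m n → + 6 * (n * (m - n)) + n * (n - 1ℤ) * (+ 3 * m - + 2 * n + 1ℤ)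
                 ≡ (1ℤ + n) * (1ℤ + n - 1ℤ) * (+ 3 * m - + 2 * (1ℤ + n) + 1ℤ)
  finish = solve-∀
  -- The upper limit n is separated from s for the induction. At n = s the last factor is s + 1,
  -- which cancels the one from `variance`.
  closed : ∀ n → + 6 * ⅀ (downFrom n) (λ j → + j * (+ s - + j)) ≡ + n * (+ n - 1ℤ) * (+ 3 * + s - + 2 * + n + 1ℤ)
  closed zero    = refl
  closed (suc n) = trans (step (+ s) (+ n) _)
    (trans (cong (λ x → + 6 * (+ n * (+ s - + n)) + x) (closed n)) (finish (+ s) (+ n)))

-- The size as a quadratic function of the first gaps

⅀-periodic : ∀ s (f : ℕ → ℤ) → (∀ i → f (i ℕ.+ s) ≡ f i) → ∀ k →
             ⅀ (downFrom s) (λ i → f (i ℕ.+ k)) ≡ ⅀ (downFrom s) f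
⅀-periodic s f per k = sym (ℤ.i-j≡0⇒i≡j _ _ (trans (range-shift k s f)
  (ℤ.i≡j⇒i-j≡0 (⅀-cong (downFrom k) λ {i} _ → sym (per i)))))

-- For i below s, s - i runs over 1, ..., s, a period shifted by one. The rotations in `⅀-rotations`
-- are indexed in this way.
⅀-reverse : ∀ s (f : ℕ → ℤ) → (∀ i → f (i ℕ.+ s) ≡ f i) →
            ⅀ (downFrom s) (λ i → f (s ℕ.∸ i)) ≡ ⅀ (downFrom s) f
⅀-reverse s f per = begin
  ⅀ (downFrom s) (λ i → f (s ℕ.∸ i))
    ≡⟨ ⅀-cong (downFrom s) (λ i∈ → cong f (sym (reflect (∈-downFrom⁻ i∈)))) ⟩
  ⅀ (downFrom s) (λ i → f (s ℕ.∸ suc i ℕ.+ 1))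
    ≡⟨ ⅀-bijection (λ i → s ℕ.∸ suc i) (λ i → s ℕ.∸ suc i) (Unique.downFrom⁺ s) (Unique.downFrom⁺ s)
         in-range in-range involutive involutive (λ i → f (i ℕ.+ 1)) ⟨
  ⅀ (downFrom s) (λ i → f (i ℕ.+ 1))
    ≡⟨ ⅀-periodic s f per 1 ⟩
  ⅀ (downFrom s) f ∎
  where
  open ≡-Reasoning
  reflect : ∀ {i} → i ℕ.< s → s ℕ.∸ suc i ℕ.+ 1 ≡ s ℕ.∸ i
  reflect {i} i<s = trans (ℕ.+-comm _ 1) (sym (ℕ.+-∸-assoc 1 i<s))
  in-range : ∀ {i} → i ∈ₗ downFrom s → s ℕ.∸ suc i ∈ₗ downFrom s
  in-range {i} i∈ = ∈-downFrom⁺ (ℕ.∸-monoʳ-< (s≤s z≤n) (∈-downFrom⁻ i∈))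
  involutive : ∀ {i} → i ∈ₗ downFrom s → s ℕ.∸ suc (s ℕ.∸ suc i) ≡ i
  involutive {i} i∈ = trans (cong (s ℕ.∸_) (trans (ℕ.+-comm 1 _) (reflect (∈-downFrom⁻ i∈))))
    (ℕ.m∸[m∸n]≡n (ℕ.<⇒≤ (∈-downFrom⁻ i∈)))

pair-sum : ∀ {A : Set} (xs : List A) (f : A → ℤ) →
  ⅀ xs (λ y → ⅀ xs (λ x → sq (f x - f y))) ≡ + 2 * (+ length xs * ⅀ xs (sq ∘ f) - sq (⅀ xs f))
pair-sum xs f = begin
  ⅀ xs (λ y → ⅀ xs (λ x → sq (f x - f y)))
    ≡⟨ ⅀-cong xs (λ {y} _ → inner y) ⟩
  ⅀ xs (λ y → n * sq (f y) + (Q - + 2 * P * f y))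
    ≡⟨ ⅀-+ xs (λ y → n * sq (f y)) _ ⟩
  ⅀ xs (λ y → n * sq (f y)) + ⅀ xs (λ y → Q - + 2 * P * f y)
    ≡⟨ cong₂ _+_ (⅀-*ˡ xs n _) (trans (⅀-minus xs (λ _ → Q) _) (cong₂ _-_ (⅀-const xs Q) (⅀-*ˡ xs (+ 2 * P) f))) ⟩
  n * Q + (n * Q - + 2 * P * P)
    ≡⟨ finish n Q P ⟩
  + 2 * (n * Q - P * P) ∎
  where
  open ≡-Reasoning
  n = + length xs
  Q = ⅀ xs (sq ∘ f)
  P = ⅀ xs f
  expand : ∀ a b → (a - b) * (a - b) ≡ b * b + (a * a - + 2 * b * a)
  expand = solve-∀
  commute : ∀ n y p q → n * (y * y) + (q - + 2 * y * p) ≡ n * (y * y) + (q - + 2 * p * y)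
  commute = solve-∀
  inner : ∀ y → ⅀ xs (λ x → sq (f x - f y)) ≡ n * sq (f y) + (Q - + 2 * P * f y)
  inner y = trans (⅀-cong xs λ {x} _ → expand (f x) (f y))
    (trans (⅀-+ xs (λ _ → sq (f y)) _)
    (trans (cong₂ _+_ (⅀-const xs (sq (f y))) (trans (⅀-minus xs (sq ∘ f) _) (cong (λ z → Q - z) (⅀-*ˡ xs (+ 2 * f y) f))))
           (commute n (f y) P Q)))
  finish : ∀ n q p → n * q + (n * q - + 2 * p * p) ≡ + 2 * (n * q - p * p)
  finish = solve-∀

module _ (s : ℕ) .{{_ : NonZero s}} {t : ℕ} {a : ℕ → ℕ} (isGap : IsGapFunction s t a)
         {U : ℕ} (a≤U : ∀ x → a x ℕ.≤ U) where

  open IsGapFunction using (residue; periodic)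

  -- For i < s the beads in the class of i are i, i + s, ..., a i - s, so the increments telescope
  -- to ψ (a i) - ψ i. Suitable ψ give the number and the sum of the beads.
  ⅀-beads : ∀ (ψ : ℕ → ℤ) → ⅀ (beadList s a U) (λ x → ψ (x ℕ.+ s) - ψ x)
                           ≡ ⅀ (downFrom s) (λ i → ψ (a i)) - ⅀ (downFrom s) ψ
  ⅀-beads ψ = begin
    ⅀ (beadList s a U) (λ x → ψ (x ℕ.+ s) - ψ x)
      ≡⟨ ⅀-filter (λ x → x ℕ.<? a x) (downFrom U) _ ⟩
    ⅀ (downFrom U) (λ x → 𝟙 (x ℕ.<? a x) * (ψ (x ℕ.+ s) - ψ x))
      ≡⟨ ⅀-cong (downFrom U) (λ {x} _ → difference x) ⟩
    ⅀ (downFrom U) (λ x → θ x - θ (x ℕ.+ s))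
      ≡⟨ ⅀-minus (downFrom U) θ _ ⟩
    ⅀ (downFrom U) θ - ⅀ (downFrom U) (λ x → θ (x ℕ.+ s))
      ≡⟨ range-shift s U θ ⟩
    ⅀ (downFrom s) θ - ⅀ (downFrom s) (λ i → θ (i ℕ.+ U))
      ≡⟨ cong₂ _-_ (⅀-cong (downFrom s) λ i∈ → low (∈-downFrom⁻ i∈))
                   (trans (⅀-cong (downFrom s) λ {i} _ → high i) (⅀-0 (downFrom s))) ⟩
    ⅀ (downFrom s) (λ i → ψ (a i) - ψ i) - 0ℤ
      ≡⟨ ℤ.+-identityʳ _ ⟩
    ⅀ (downFrom s) (λ i → ψ (a i) - ψ i)
      ≡⟨ ⅀-minus (downFrom s) (ψ ∘ a) ψ ⟩
    ⅀ (downFrom s) (λ i → ψ (a i)) - ⅀ (downFrom s) ψ ∎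
    where
    open ≡-Reasoning
    -- The weights of the beads of its residue class from x upwards add up to θ x.
    θ : ℕ → ℤ
    θ x = ψ (x ℕ.⊔ a x) - ψ x
    θ-below : ∀ {x} → x ℕ.≤ a x → θ x ≡ ψ (a x) - ψ x
    θ-below x≤ = cong (λ y → ψ y - ψ _) (ℕ.m≤n⇒m⊔n≡n x≤)
    θ-above : ∀ {x} → a x ℕ.≤ x → θ x ≡ 0ℤ
    θ-above {x} ≤x = trans (cong (λ y → ψ y - ψ x) (ℕ.m≥n⇒m⊔n≡m ≤x)) (ℤ.+-inverseʳ (ψ x))
    a-shift : ∀ x → a (x ℕ.+ s) ≡ a x
    a-shift x = periodic isGap ([m+n]%n≡m%n x s)
    difference : ∀ x → 𝟙 (x ℕ.<? a x) * (ψ (x ℕ.+ s) - ψ x) ≡ θ x - θ (x ℕ.+ s)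
    difference x with x ℕ.<? a x
    ... | yes x< = sym (trans (cong₂ _-_ (θ-below (ℕ.<⇒≤ x<))
        (trans (θ-below (subst (x ℕ.+ s ℕ.≤_) (sym (a-shift x)) (≡ₛ-<⇒+≤ s (sym (residue isGap x)) x<)))
               (cong (λ y → ψ y - ψ (x ℕ.+ s)) (a-shift x))))
        (cancel (ψ (a x)) (ψ x) (ψ (x ℕ.+ s))))
      where
      cancel : ∀ a x y → (a - x) - (a - y) ≡ 1ℤ * (y - x)
      cancel = solve-∀
    ... | no x≮  = sym (cong₂ _-_ (θ-above (ℕ.≮⇒≥ x≮))
        (θ-above (subst (ℕ._≤ x ℕ.+ s) (sym (a-shift x)) (ℕ.≤-trans (ℕ.≮⇒≥ x≮) (ℕ.m≤m+n x s)))))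
    low : ∀ {i} → i ℕ.< s → θ i ≡ ψ (a i) - ψ i
    low {i} i<s = θ-below (subst (ℕ._≤ a i) (trans (residue isGap i) (m<n⇒m%n≡m i<s)) (m%n≤m (a i) s))
    high : ∀ i → θ (i ℕ.+ U) ≡ 0ℤ
    high i = θ-above (ℕ.≤-trans (a≤U _) (ℕ.m≤n+m U i))

  private
    I₁ I₂ A₁ A₂ L Σx : ℤ
    I₁ = ⅀ (downFrom s) (λ i → + i)
    I₂ = ⅀ (downFrom s) (λ i → sq (+ i))
    A₁ = ⅀ (downFrom s) (λ i → + a i)
    A₂ = ⅀ (downFrom s) (λ i → sq (+ a i))
    L  = + length (beadList s a U)
    Σx = ⅀ (beadList s a U) (λ x → + x)

    count : + s * L ≡ A₁ - I₁
    count = trans (ℤ.*-comm (+ s) L) (trans (sym (⅀-const (beadList s a U) (+ s)))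
      (trans (⅀-cong (beadList s a U) λ {x} _ → sym (difference (+ x) (+ s))) (⅀-beads (λ x → + x))))
      where
      difference : ∀ x s → x + s - x ≡ s
      difference = solve-∀

    ⅀-quadratic : ∀ (f : ℕ → ℕ) → ⅀ (downFrom s) (λ i → sq (+ f i) - + s * + f i)
                      ≡ ⅀ (downFrom s) (λ i → sq (+ f i)) - + s * ⅀ (downFrom s) (λ i → + f i)
    ⅀-quadratic f = trans (⅀-minus (downFrom s) (λ i → sq (+ f i)) _)
      (cong (λ z → ⅀ (downFrom s) (λ i → sq (+ f i)) - z) (⅀-*ˡ (downFrom s) (+ s) (λ i → + f i)))

    -- The function y² - s y is chosen because its increment from x to x + s is exactly 2 s x.
    total : + 2 * + s * Σx ≡ (A₂ - + s * A₁) - (I₂ - + s * I₁)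
    total = trans (sym (⅀-*ˡ (beadList s a U) (+ 2 * + s) (λ x → + x)))
      (trans (⅀-cong (beadList s a U) λ {x} _ → sym (difference (+ x) (+ s)))
      (trans (⅀-beads (λ y → sq (+ y) - + s * + y))
             (cong₂ _-_ (⅀-quadratic a) (⅀-quadratic (λ i → i)))))
      where
      difference : ∀ x s → ((x + s) * (x + s) - s * (x + s)) - (x * x - s * x) ≡ + 2 * s * x
      difference = solve-∀

    2*I₁ : ∀ n → + 2 * ⅀ (downFrom n) (λ i → + i) ≡ + n * (+ n - 1ℤ)
    2*I₁ zero    = refl
    2*I₁ (suc n) = trans (ℤ.*-distribˡ-+ (+ 2) (+ n) _) (trans (cong (λ x → + 2 * + n + x) (2*I₁ n)) (step (+ n)))
      where
      step : ∀ n → + 2 * n + n * (n - 1ℤ) ≡ (1ℤ + n) * (1ℤ + n - 1ℤ)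
      step = solve-∀

    6*I₂ : ∀ n → + 6 * ⅀ (downFrom n) (λ i → sq (+ i)) ≡ + n * (+ n - 1ℤ) * (+ 2 * + n - 1ℤ)
    6*I₂ zero    = refl
    6*I₂ (suc n) = trans (ℤ.*-distribˡ-+ (+ 6) (sq (+ n)) _) (trans (cong (λ x → + 6 * sq (+ n) + x) (6*I₂ n)) (step (+ n)))
      where
      step : ∀ n → + 6 * (n * n) + n * (n - 1ℤ) * (+ 2 * n - 1ℤ) ≡ (1ℤ + n) * (1ℤ + n - 1ℤ) * (+ 2 * (1ℤ + n) - 1ℤ)
      step = solve-∀

    size-beads : + 2 * Σx + L ≡ + 2 * + size (toPartition s a U) + L * L
    size-beads = begin
      + 2 * Σx + L
        ≡⟨ cong (λ x → + 2 * x + L) (trans (sym (⅀-sum (beadList s a U) (λ x → x)))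
             (cong (λ xs → + sum xs) (trans (map-id (beadList s a U)) (sym (beads-fromBeads (beadList-decreasing s a U)))))) ⟩
      + 2 * + sum (beads (toPartition s a U)) + L
        ≡⟨ cong (_+ L) (ℤ.pos-* 2 (sum (beads (toPartition s a U)))) ⟨
      + (2 ℕ.* sum (beads (toPartition s a U)) ℕ.+ length (beadList s a U))
        ≡⟨ cong (λ n → + n) (sum-beads (toPartition s a U)) ⟩
      + (2 ℕ.* size (toPartition s a U) ℕ.+ length (beadList s a U) ℕ.* length (beadList s a U))
        ≡⟨ cong₂ _+_ (ℤ.pos-* 2 (size (toPartition s a U))) (ℤ.pos-* (length (beadList s a U)) (length (beadList s a U))) ⟩
      + 2 * + size (toPartition s a U) + L * L ∎
      where open ≡-Reasoning

  -- `size-beads` expresses the size by the number and sum of the beads, `count` and `total` express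
  -- these by the gaps. I₁ and I₂ are the values of A₁ and A₂ for the empty partition and produce
  -- the constant s² (s² - 1).
  size-formula : + 24 * (+ s * + s) * + size (toPartition s a U) + + s * + s * (+ s * + s - 1ℤ)
               ≡ + 12 * (+ s * A₂ - sq A₁)
  size-formula = begin
    + 24 * (+ s * + s) * Z + + s * + s * (+ s * + s - 1ℤ)
      ≡⟨ step₁ (+ s) Z L ⟩
    + 12 * (+ s * + s) * (+ 2 * Z + L * L) - + 12 * ((+ s * L) * (+ s * L)) + + s * + s * (+ s * + s - 1ℤ)
      ≡⟨ cong (λ x → + 12 * (+ s * + s) * x - + 12 * ((+ s * L) * (+ s * L)) + + s * + s * (+ s * + s - 1ℤ)) size-beads ⟨
    + 12 * (+ s * + s) * (+ 2 * Σx + L) - + 12 * ((+ s * L) * (+ s * L)) + + s * + s * (+ s * + s - 1ℤ)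
      ≡⟨ step₂ (+ s) Σx L ⟩
    + 12 * + s * (+ 2 * + s * Σx + + s * L) - + 12 * ((+ s * L) * (+ s * L)) + + s * + s * (+ s * + s - 1ℤ)
      ≡⟨ cong₂ (λ x y → + 12 * + s * (x + y) - + 12 * (y * y) + + s * + s * (+ s * + s - 1ℤ)) total count ⟩
    + 12 * + s * ((A₂ - + s * A₁) - (I₂ - + s * I₁) + (A₁ - I₁)) - + 12 * ((A₁ - I₁) * (A₁ - I₁)) + + s * + s * (+ s * + s - 1ℤ)
      ≡⟨ step₃ (+ s) A₁ A₂ I₁ I₂ ⟩
    + 12 * (+ s * A₂ - A₁ * A₁) + (+ 12 * A₁ * (+ 2 * I₁) - + 12 * + s * (+ s - 1ℤ) * A₁)
      + (+ 6 * + s * (+ s - 1ℤ) * (+ 2 * I₁) - + 3 * ((+ 2 * I₁) * (+ 2 * I₁)) - + 2 * + s * (+ 6 * I₂)) + + s * + s * (+ s * + s - 1ℤ)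
      ≡⟨ cong₂ (λ x y → + 12 * (+ s * A₂ - A₁ * A₁) + (+ 12 * A₁ * x - + 12 * + s * (+ s - 1ℤ) * A₁)
      + (+ 6 * + s * (+ s - 1ℤ) * x - + 3 * (x * x) - + 2 * + s * y) + + s * + s * (+ s * + s - 1ℤ)) (2*I₁ s) (6*I₂ s) ⟩
    _ ≡⟨ step₄ (+ s) A₁ A₂ ⟩
    + 12 * (+ s * A₂ - A₁ * A₁) ∎
    where
    open ≡-Reasoning
    Z = + size (toPartition s a U)
    step₁ : ∀ s z l → + 24 * (s * s) * z + s * s * (s * s - 1ℤ)
      ≡ + 12 * (s * s) * (+ 2 * z + l * l) - + 12 * ((s * l) * (s * l)) + s * s * (s * s - 1ℤ)
    step₁ = solve-∀
    step₂ : ∀ s x l → + 12 * (s * s) * (+ 2 * x + l) - + 12 * ((s * l) * (s * l)) + s * s * (s * s - 1ℤ)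
      ≡ + 12 * s * (+ 2 * s * x + s * l) - + 12 * ((s * l) * (s * l)) + s * s * (s * s - 1ℤ)
    step₂ = solve-∀
    step₃ : ∀ s a b i j → + 12 * s * ((b - s * a) - (j - s * i) + (a - i)) - + 12 * ((a - i) * (a - i)) + s * s * (s * s - 1ℤ)
      ≡ + 12 * (s * b - a * a) + (+ 12 * a * (+ 2 * i) - + 12 * s * (s - 1ℤ) * a)
      + (+ 6 * s * (s - 1ℤ) * (+ 2 * i) - + 3 * ((+ 2 * i) * (+ 2 * i)) - + 2 * s * (+ 6 * j)) + s * s * (s * s - 1ℤ)
    step₃ = solve-∀
    step₄ : ∀ s a b → + 12 * (s * b - a * a) + (+ 12 * a * (s * (s - 1ℤ)) - + 12 * s * (s - 1ℤ) * a)
      + (+ 6 * s * (s - 1ℤ) * (s * (s - 1ℤ)) - + 3 * ((s * (s - 1ℤ)) * (s * (s - 1ℤ)))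
          - + 2 * s * (s * (s - 1ℤ) * (+ 2 * s - 1ℤ))) + s * s * (s * s - 1ℤ)
      ≡ + 12 * (s * b - a * a)
    step₄ = solve-∀

-- The cycle lemma and the mean size

module _ (s : ℕ) .{{_ : NonZero s}} (t u : ℕ) (t*u≡1 : t ℕ.* u % s ≡ 1 % s) where

  -- Integer-valued because it may go negative before rotation; on Dyck paths with sum t it agrees
  -- with `depth`.
  walk : Vec ℕ s → ℕ → ℤ
  walk v j = + j * + t - + s * + height s v j

  walk-rotate : ∀ k v j → walk (rotate s k v) j ≡ walk v (j ℕ.+ k) - walk v k
  walk-rotate k v j rewrite sym (height-rotate s k v j) =
    lemma (+ s) (+ t) (+ j) (+ k) (+ height s (rotate s k v) j) (+ height s v k)
    where
    lemma : ∀ s t j k h h′ → j * t - s * h ≡ (j + k) * t - s * (h′ + h) - (k * t - s * h′)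
    lemma = solve-∀

  walk-periodic : ∀ v → Vec.sum v ≡ t → ∀ j → walk v (j ℕ.+ s) ≡ walk v j
  walk-periodic v sum≡t j rewrite height-+s s v j | sum≡t = lemma (+ s) (+ t) (+ j) (+ height s v j)
    where
    lemma : ∀ s t j h → (j + s) * t - s * (t + h) ≡ j * t - s * h
    lemma = solve-∀

  walk-% : ∀ v → Vec.sum v ≡ t → ∀ j → walk v (j % s) ≡ walk v j
  walk-% v sum≡t = periodic-% s {f = walk v} (walk-periodic v sum≡t)

  height⇒walk : ∀ v j → s ℕ.* height s v j ℕ.≤ j ℕ.* t → 0ℤ ≤ walk v j
  height⇒walk v j le = ℤ.i≤j⇒0≤j-i (subst₂ _≤_ (ℤ.pos-* s _) (ℤ.pos-* j t) (+≤+ le))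

  walk⇒height : ∀ v j → 0ℤ ≤ walk v j → s ℕ.* height s v j ℕ.≤ j ℕ.* t
  walk⇒height v j le = ℤ.drop‿+≤+ (subst₂ _≤_ (sym (ℤ.pos-* s _)) (sym (ℤ.pos-* j t)) (ℤ.0≤i-j⇒j≤i le))

  dyck-depth : ∀ v → Vec.sum v ≡ t → Dyck s t v → ∀ j → + depth s t v j ≡ walk v j
  dyck-depth v sum≡t dyck j = trans (add-subtract (+ depth s t v j) (+ s * + height s v j))
    (cong (_- + s * + height s v j) (trans (cong (λ x → + depth s t v j + x) (sym (ℤ.pos-* s _)))
      (trans (cong (λ n → + n) (depth+ s t v sum≡t dyck j)) (ℤ.pos-* j t))))
    where
    add-subtract : ∀ d h → d ≡ d + h - h
    add-subtract = solve-∀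

  module _ (v : Vec ℕ s) (sum≡t : Vec.sum v ≡ t) where

    Lowest : ℕ → Set
    Lowest k = ∀ j → walk v k ≤ walk v j

    lowest⇒dyck : ∀ {k} → Lowest k → Dyck s t (rotate s k v)
    lowest⇒dyck {k} lowest {j} _ = walk⇒height (rotate s k v) j
      (subst (0ℤ ≤_) (sym (walk-rotate k v j)) (ℤ.i≤j⇒0≤j-i (lowest (j ℕ.+ k))))

    -- Starting at k, the walk meets position j one period later, after j + (s - k) steps, so
    -- nonnegativity of the rotated walk compares j with k.
    dyck⇒lowest : ∀ {k} → k ℕ.< s → Dyck s t (rotate s k v) → Lowest k
    dyck⇒lowest {k} k<s dyck j = ℤ.0≤i-j⇒j≤i (subst (0ℤ ≤_)
      (trans (walk-rotate k v j′) (cong (_- walk v k) walk-j′))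
      (height⇒walk (rotate s k v) j′ (dyck-all s t (rotate s k v) (trans (sum-rotate s k v) sum≡t) dyck j′)))
      where
      j′ = j ℕ.+ (s ℕ.∸ k)
      walk-j′ : walk v (j′ ℕ.+ k) ≡ walk v j
      walk-j′ = trans (cong (walk v) (trans (ℕ.+-assoc j (s ℕ.∸ k) k) (cong (j ℕ.+_) (ℕ.m∸n+n≡m (ℕ.<⇒≤ k<s)))))
        (walk-periodic v sum≡t j)

    lowest-exists : ∃ λ k → k ℕ.< s × Lowest k
    -- By periodicity one period suffices. The default 0 of `argmin` lies below s, so it adds no
    -- candidate outside the period.
    lowest-exists = argmin (walk v) 0 (downFrom s)
      , argmin-all (walk v) {0} {downFrom s} (ℕ.n≢0⇒n>0 (ℕ.≢-nonZero⁻¹ s)) (All.tabulate ∈-downFrom⁻)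
      , λ j → subst (walk v (argmin (walk v) 0 (downFrom s)) ≤_) (walk-% v sum≡t j)
          (All.lookup (f[argmin]≤f[xs] {f = walk v} 0 (downFrom s)) (∈-downFrom⁺ (m%n<n j s)))

    -- Since t is invertible modulo s, the walk takes distinct values at distinct
    -- times below s, so its minimum is attained only once.
    lowest-unique : ∀ {k l} → k ℕ.< s → l ℕ.< s → Lowest k → Lowest l → k ≡ l
    lowest-unique {k} {l} k<s l<s lk ll = begin
      k                          ≡⟨ m<n⇒m%n≡m k<s ⟨
      k % s                      ≡⟨ *t*u s t u t*u≡1 k ⟨
      (k ℕ.* t ℕ.* u) % s        ≡⟨ *-congₛ s {k ℕ.* t} {l ℕ.* t} {u} {u} kt≡lt refl ⟩
      (l ℕ.* t ℕ.* u) % s        ≡⟨ *t*u s t u t*u≡1 l ⟩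
      l % s                      ≡⟨ m<n⇒m%n≡m l<s ⟩
      l ∎
      where
      open ≡-Reasoning
      cross : ∀ a b c d → a - b ≡ c - d → a + d ≡ c + b
      cross a b c d eq = trans (lemma₁ a b d) (trans (cong (λ x → x + (b + d)) eq) (lemma₂ b c d))
        where
        lemma₁ : ∀ a b d → a + d ≡ a - b + (b + d)
        lemma₁ = solve-∀
        lemma₂ : ∀ b c d → c - d + (b + d) ≡ c + b
        lemma₂ = solve-∀
      natural : ∀ k h → + (k ℕ.* t ℕ.+ h ℕ.* s) ≡ + k * + t + + s * + h
      natural k h = cong₂ _+_ (ℤ.pos-* k t) (trans (ℤ.pos-* h s) (ℤ.*-comm (+ h) (+ s)))
      crossed : k ℕ.* t ℕ.+ height s v l ℕ.* s ≡ l ℕ.* t ℕ.+ height s v k ℕ.* s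
      crossed = ℤ.+-injective (trans (natural k (height s v l))
        (trans (cross (+ k * + t) (+ s * + height s v k) (+ l * + t) (+ s * + height s v l) (ℤ.≤-antisym (lk l) (ll k)))
               (sym (natural l (height s v k)))))
      kt≡lt : (k ℕ.* t) % s ≡ (l ℕ.* t) % s
      kt≡lt = trans (sym ([m+kn]%n≡m%n (k ℕ.* t) (height s v l) s))
        (trans (cong (_% s) crossed) ([m+kn]%n≡m%n (l ℕ.* t) (height s v k) s))

    cycle-lemma : ⅀ (downFrom s) (λ k → 𝟙 (dyck? s t (rotate s k v))) ≡ 1ℤ
    cycle-lemma with k , k<s , lowest ← lowest-exists =
      ⅀-𝟙-unique (λ k → dyck? s t (rotate s k v)) (Unique.downFrom⁺ s) (∈-downFrom⁺ k<s) (lowest⇒dyck lowest)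
        λ l∈ dyck → lowest-unique (∈-downFrom⁻ l∈) k<s (dyck⇒lowest (∈-downFrom⁻ l∈) dyck) lowest

  dyckPaths : List (Vec ℕ s)
  dyckPaths = filter (dyck? s t) (compositions s t)

  dyckPaths⁻ : ∀ {v} → v ∈ₗ dyckPaths → Vec.sum v ≡ t × Dyck s t v
  dyckPaths⁻ v∈ with v∈′ , dyck ← ∈-filter⁻ (dyck? s t) {xs = compositions s t} v∈ = ∈-compositions⁻ s t v∈′ , dyck

  rotate-∈ : ∀ k {v} → v ∈ₗ compositions s t → rotate s k v ∈ₗ compositions s t
  rotate-∈ k {v} v∈ = ∈-compositions⁺ t _ (trans (sum-rotate s k v) (∈-compositions⁻ s t v∈))

  -- By the cycle lemma, f v may be multiplied by the number of k for which rotation by k makes v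
  -- Dyck. Exchanging the sums and substituting, for each k, the rotation w of v leaves a sum over
  -- Dyck paths w.
  ⅀-rotations : ∀ f → ⅀ (compositions s t) f ≡ ⅀ dyckPaths (λ w → ⅀ (downFrom s) (λ k → f (rotate s (s ℕ.∸ k) w)))
  ⅀-rotations f = begin
    ⅀ (compositions s t) f
      ≡⟨ ⅀-cong (compositions s t) (λ {v} v∈ → sym (trans
           (cong (_* f v) (cycle-lemma v (∈-compositions⁻ s t v∈))) (ℤ.*-identityˡ (f v)))) ⟩
    ⅀ (compositions s t) (λ v → ⅀ (downFrom s) (λ k → dyck k v) * f v)
      ≡⟨ ⅀-cong (compositions s t) (λ {v} _ → trans (ℤ.*-comm _ (f v)) (sym (⅀-*ˡ (downFrom s) (f v) _))) ⟩
    ⅀ (compositions s t) (λ v → ⅀ (downFrom s) (λ k → f v * dyck k v))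
      ≡⟨ ⅀-comm (compositions s t) (downFrom s) _ ⟩
    ⅀ (downFrom s) (λ k → ⅀ (compositions s t) (λ v → f v * dyck k v))
      ≡⟨ ⅀-cong (downFrom s) (λ {k} k∈ → substitute k (∈-downFrom⁻ k∈)) ⟩
    ⅀ (downFrom s) (λ k → ⅀ (compositions s t) (λ w → 𝟙 (dyck? s t w) * f (rotate s (s ℕ.∸ k) w)))
      ≡⟨ ⅀-cong (downFrom s) (λ {k} _ → ⅀-filter (dyck? s t) (compositions s t) _) ⟨
    ⅀ (downFrom s) (λ k → ⅀ dyckPaths (λ w → f (rotate s (s ℕ.∸ k) w)))
      ≡⟨ ⅀-comm (downFrom s) dyckPaths _ ⟩
    ⅀ dyckPaths (λ w → ⅀ (downFrom s) (λ k → f (rotate s (s ℕ.∸ k) w))) ∎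
    where
    open ≡-Reasoning
    dyck : ℕ → Vec ℕ s → ℤ
    dyck k v = 𝟙 (dyck? s t (rotate s k v))
    substitute : ∀ k → k ℕ.< s → ⅀ (compositions s t) (λ v → f v * dyck k v)
                                ≡ ⅀ (compositions s t) (λ w → 𝟙 (dyck? s t w) * f (rotate s (s ℕ.∸ k) w))
    substitute k k<s = trans
      (⅀-bijection (rotate s (s ℕ.∸ k)) (rotate s k) (compositions-unique s t) (compositions-unique s t)
        (rotate-∈ (s ℕ.∸ k)) (rotate-∈ k) (λ {w} _ → back w)
        (λ {v} _ → rotate-inverse s (s ℕ.∸ k) k v (ℕ.m∸n+n≡m (ℕ.<⇒≤ k<s))) _)
      (⅀-cong (compositions s t) λ {w} _ → trans (ℤ.*-comm (f (rotate s (s ℕ.∸ k) w)) _)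
        (cong (λ w′ → 𝟙 (dyck? s t w′) * f (rotate s (s ℕ.∸ k) w)) (back w)))
      where
      back : ∀ w → rotate s k (rotate s (s ℕ.∸ k) w) ≡ w
      back w = rotate-inverse s k (s ℕ.∸ k) w (ℕ.m+[n∸m]≡n (ℕ.<⇒≤ k<s))

  -- The correspondence between Dyck paths and simultaneous cores

  corePartition : Vec ℕ s → Partition
  corePartition v = toPartition s (gapAt s t u t*u≡1 v) (s ℕ.* t)

  gapAt-≤ : ∀ v → Vec.sum v ≡ t → ∀ x → gapAt s t u t*u≡1 v x ℕ.≤ s ℕ.* t
  gapAt-≤ v sum≡t x = depth-≤ s t v sum≡t (x ℕ.* u)

  core-sound : ∀ {v} → v ∈ₗ dyckPaths → (IsCore s ∩ IsCore t) (corePartition v)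
  core-sound {v} v∈ = let sum≡t , dyck = dyckPaths⁻ v∈ ; isGap = gapAt-isGapFunction s t u t*u≡1 v sum≡t dyck in
    toPartition-core-s s isGap {s ℕ.* t} (gapAt-≤ v sum≡t) , toPartition-core-t s isGap {s ℕ.* t} (gapAt-≤ v sum≡t)

  core-injective : ∀ {v w} → v ∈ₗ dyckPaths → w ∈ₗ dyckPaths → corePartition v ≈ corePartition w → v ≡ w
  core-injective {v} {w} v∈ w∈ eq =
    let v-sum , v-dyck = dyckPaths⁻ v∈ ; w-sum , w-dyck = dyckPaths⁻ w∈ in
    gapAt-injective s t u t*u≡1 v w v-sum v-dyck w-sum w-dyck
      (toPartition-injective s {U = s ℕ.* t}
        (gapAt-isGapFunction s t u t*u≡1 v v-sum v-dyck) (gapAt-isGapFunction s t u t*u≡1 w w-sum w-dyck)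
        (gapAt-≤ v v-sum) (gapAt-≤ w w-sum) eq)

  -- The gap function of the beads of p comes from a path v, and the same condition x < a x then
  -- describes the beads of p and of `corePartition v`.
  core-surjective : ∀ p → Reduced p → IsCore s p → IsCore t p → 1 ℕ.≤ t →
                    ∃ λ v → v ∈ₗ dyckPaths × p ≈ corePartition v
  core-surjective p reduced core-s core-t t≥1 =
    let a , isGap , a⁺ , a⁻ = closed⇒gapFunction s (beads p) (reduced⇒0∉beads {p} reduced)
          (core⇒closed p core-s (ℕ.n≢0⇒n>0 (ℕ.≢-nonZero⁻¹ s))) (core⇒closed p core-t t≥1)
        v , sum≡t , dyck , a≡ = gapAt-surjective s t u t*u≡1 isGap
    in v , ∈-filter⁺ (dyck? s t) (∈-compositions⁺ t v sum≡t) dyck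
     , beads-injective p (corePartition v) (strictlyDecreasing-unique
        (beads-strictlyDecreasing p) (beads-strictlyDecreasing (corePartition v))
        (λ {x} x∈ → bead⁺ s (gapAt s t u t*u≡1 v) (s ℕ.* t) (gapAt-≤ v sum≡t) (subst (x ℕ.<_) (a≡ x) (a⁺ x∈)))
        (λ {x} x∈ → a⁻ (subst (x ℕ.<_) (sym (a≡ x)) (bead⁻ s (gapAt s t u t*u≡1 v) (s ℕ.* t) x∈))))

  enumeration : 1 ℕ.≤ t → Enumeration (IsCore s ∩ IsCore t)
  enumeration t≥1 = record
    { elements = map corePartition dyckPaths
    ; sound    = All.map⁺ {xs = dyckPaths} (All.tabulate core-sound)
    ; complete = λ p (core-s , core-t) →
        let q , reduced , p≈q = reduce p
            v , v∈ , q≈v = core-surjective q reduced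
              (core-resp-≈ {s} {p} {q} p≈q core-s) (core-resp-≈ {t} {p} {q} p≈q core-t) t≥1
        in Any.map⁺ {xs = dyckPaths} (Any.map (λ { refl r → trans (p≈q r) (q≈v r) }) v∈)
    ; unique   = AllPairs.map⁺ (AllPairs-map-on
        (λ v∈ w∈ v≢w eq → v≢w (core-injective v∈ w∈ eq))
        (All.tabulate (λ v∈ → v∈)) (Unique.filter⁺ (dyck? s t) (compositions-unique s t)))
    }

  -- Averaging the size

  F₀ : Vec ℕ s → ℤ
  F₀ v = ⅀ (downFrom s) (λ j → sq (+ j * + t - + s * + prefixSum j v))

  F₀-rotations : ∀ v → Vec.sum v ≡ t → Dyck s t v →
    + 6 * ⅀ (downFrom s) (λ k → F₀ (rotate s (s ℕ.∸ k) v))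
      ≡ + 24 * (+ s * + s) * + size (corePartition v) + + s * + s * (+ s * + s - 1ℤ)
  F₀-rotations v sum≡t dyck = begin
    + 6 * ⅀ (downFrom s) (λ k → F₀ (rotate s (s ℕ.∸ k) v))
      ≡⟨ cong (+ 6 *_) (⅀-cong (downFrom s) λ {k} _ → F₀-rotate (s ℕ.∸ k)) ⟩
    + 6 * ⅀ (downFrom s) (λ k → spread (s ℕ.∸ k))
      ≡⟨ cong (+ 6 *_) (⅀-reverse s spread λ k →
           cong (λ y → ⅀ (downFrom s) (λ j → sq (walk v j - y))) (walk-periodic v sum≡t k)) ⟩
    + 6 * ⅀ (downFrom s) spread
      ≡⟨ cong (+ 6 *_) (pair-sum (downFrom s) (walk v)) ⟩
    + 6 * (+ 2 * (+ length (downFrom s) * ⅀ (downFrom s) (sq ∘ walk v) - sq (⅀ (downFrom s) (walk v))))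
      ≡⟨ cong (λ n → + 6 * (+ 2 * (+ n * ⅀ (downFrom s) (sq ∘ walk v) - sq (⅀ (downFrom s) (walk v))))) (length-downFrom s) ⟩
    + 6 * (+ 2 * (+ s * ⅀ (downFrom s) (sq ∘ walk v) - sq (⅀ (downFrom s) (walk v))))
      ≡⟨ double _ ⟩
    + 12 * (+ s * ⅀ (downFrom s) (sq ∘ walk v) - sq (⅀ (downFrom s) (walk v)))
      ≡⟨ cong₂ (λ x y → + 12 * (+ s * x - sq y)) (reindex sq) (reindex (λ x → x)) ⟨
    + 12 * (+ s * ⅀ (downFrom s) (λ i → sq (+ gap′ i)) - sq (⅀ (downFrom s) (λ i → + gap′ i)))
      ≡⟨ size-formula s (gapAt-isGapFunction s t u t*u≡1 v sum≡t dyck) (gapAt-≤ v sum≡t) ⟨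
    + 24 * (+ s * + s) * + size (corePartition v) + + s * + s * (+ s * + s - 1ℤ) ∎
    where
    open ≡-Reasoning
    gap′ = gapAt s t u t*u≡1 v
    double : ∀ x → + 6 * (+ 2 * x) ≡ + 12 * x
    double = solve-∀
    spread : ℕ → ℤ
    spread k = ⅀ (downFrom s) (λ j → sq (walk v j - walk v k))
    F₀-rotate : ∀ k → F₀ (rotate s k v) ≡ spread k
    F₀-rotate k = trans
      (⅀-cong (downFrom s) λ {j} j∈ → cong sq (trans
        (cong (λ h → + j * + t - + s * + h) (prefixSum≡height s (rotate s k v) (ℕ.<⇒≤ (∈-downFrom⁻ j∈))))
        (walk-rotate k v j)))
      (⅀-periodic s (λ j → sq (walk v j - walk v k)) (λ j → cong (λ y → sq (y - walk v k)) (walk-periodic v sum≡t j)) k)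
    -- `size-formula` lists the first gaps by residue, the walk lists them by time; i ↦ i u and j ↦
    -- j t modulo s pass between the two orders.
    reindex : ∀ (h : ℤ → ℤ) → ⅀ (downFrom s) (λ i → h (+ gap′ i)) ≡ ⅀ (downFrom s) (h ∘ walk v)
    reindex h = trans
      (⅀-cong (downFrom s) λ {i} _ → cong h (trans (dyck-depth v sum≡t dyck (i ℕ.* u)) (sym (walk-% v sum≡t (i ℕ.* u)))))
      (sym (⅀-bijection (λ i → (i ℕ.* u) % s) (λ j → (j ℕ.* t) % s) (Unique.downFrom⁺ s) (Unique.downFrom⁺ s)
        (λ {i} _ → ∈-downFrom⁺ (m%n<n (i ℕ.* u) s)) (λ {j} _ → ∈-downFrom⁺ (m%n<n (j ℕ.* t) s))
        (λ {i} i∈ → trans (*-congₛ s {(i ℕ.* u) % s} {i ℕ.* u} {t} {t} (m%n%n≡m%n (i ℕ.* u) s) refl)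
                      (trans (*u*t s t u t*u≡1 i) (m<n⇒m%n≡m (∈-downFrom⁻ i∈))))
        (λ {j} j∈ → trans (*-congₛ s {(j ℕ.* t) % s} {j ℕ.* t} {u} {u} (m%n%n≡m%n (j ℕ.* t) s) refl)
                      (trans (*t*u s t u t*u≡1 j) (m<n⇒m%n≡m (∈-downFrom⁻ j∈))))
        (h ∘ walk v)))

  mean-formula : ∀ t≥1 → + 24 * + ∑ (enumeration t≥1) size
                       ≡ (+ s - + 1) * (+ t - + 1) * (+ s + + t + + 1) * + ∑ (enumeration t≥1) (λ _ → 1)
  mean-formula t≥1 = trans (cong (+ 24 *_) (∑≡⅀ size)) (trans
    (cancel-s² (isolate main)) (cong ((+ s - + 1) * (+ t - + 1) * (+ s + + t + + 1) *_) (sym (∑≡⅀ (λ _ → 1)))))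
    where
    open ≡-Reasoning
    T M : ℤ
    T = ⅀ dyckPaths (λ v → + size (corePartition v))
    M = ⅀ dyckPaths (λ _ → 1ℤ)
    ∑≡⅀ : ∀ f → + ∑ (enumeration t≥1) f ≡ ⅀ dyckPaths (λ v → + f (corePartition v))
    ∑≡⅀ f = trans (cong (λ xs → + sum xs) (sym (map-∘ dyckPaths))) (⅀-sum dyckPaths (f ∘ corePartition))
    N≡sM : N₀ s t ≡ + s * M
    N≡sM = trans (⅀-rotations (λ _ → 1ℤ)) (trans
      (⅀-cong dyckPaths λ _ → trans (⅀-const (downFrom s) 1ℤ) (cong (λ n → + n * 1ℤ) (length-downFrom s)))
      (⅀-*ˡ dyckPaths (+ s) (λ _ → 1ℤ)))
    main : + 24 * (+ s * + s) * T + + s * + s * (+ s * + s - 1ℤ) * M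
         ≡ + t * (+ s + + t) * (+ s * (+ s - 1ℤ)) * (+ s * M)
    main = begin
      + 24 * (+ s * + s) * T + + s * + s * (+ s * + s - 1ℤ) * M
        ≡⟨ cong₂ _+_ (⅀-*ˡ dyckPaths (+ 24 * (+ s * + s)) _) (⅀-*ˡ dyckPaths (+ s * + s * (+ s * + s - 1ℤ)) (λ _ → 1ℤ)) ⟨
      ⅀ dyckPaths (λ v → + 24 * (+ s * + s) * + size (corePartition v)) + ⅀ dyckPaths (λ _ → + s * + s * (+ s * + s - 1ℤ) * 1ℤ)
        ≡⟨ ⅀-+ dyckPaths _ _ ⟨
      ⅀ dyckPaths (λ v → + 24 * (+ s * + s) * + size (corePartition v) + + s * + s * (+ s * + s - 1ℤ) * 1ℤ)
        ≡⟨ ⅀-cong dyckPaths (λ {v} v∈ → let sum≡t , dyck = dyckPaths⁻ v∈ in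
             trans (F₀-rotations v sum≡t dyck) (cong (λ x → + 24 * (+ s * + s) * + size (corePartition v) + x)
                                                     (sym (ℤ.*-identityʳ (+ s * + s * (+ s * + s - 1ℤ)))))) ⟨
      ⅀ dyckPaths (λ v → + 6 * ⅀ (downFrom s) (λ k → F₀ (rotate s (s ℕ.∸ k) v)))
        ≡⟨ ⅀-*ˡ dyckPaths (+ 6) _ ⟩
      + 6 * ⅀ dyckPaths (λ v → ⅀ (downFrom s) (λ k → F₀ (rotate s (s ℕ.∸ k) v)))
        ≡⟨ cong (+ 6 *_) (⅀-rotations F₀) ⟨
      + 6 * ⅀ (compositions s t) F₀
        ≡⟨ sum-squares s t ⟩
      + t * (+ s + + t) * (+ s * (+ s - 1ℤ)) * N₀ s t
        ≡⟨ cong (+ t * (+ s + + t) * (+ s * (+ s - 1ℤ)) *_) N≡sM ⟩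
      + t * (+ s + + t) * (+ s * (+ s - 1ℤ)) * (+ s * M) ∎
    isolate : + 24 * (+ s * + s) * T + + s * + s * (+ s * + s - 1ℤ) * M
                ≡ + t * (+ s + + t) * (+ s * (+ s - 1ℤ)) * (+ s * M) →
              + s * (+ s * (+ 24 * T)) ≡ + s * (+ s * ((+ s - + 1) * (+ t - + 1) * (+ s + + t + + 1) * M))
    isolate eq = trans (lemma₁ (+ s) T M) (trans (cong (_- + s * + s * (+ s * + s - 1ℤ) * M) eq) (lemma₂ (+ s) (+ t) M))
      where
      lemma₁ : ∀ s a m → s * (s * (+ 24 * a)) ≡ + 24 * (s * s) * a + s * s * (s * s - 1ℤ) * m - s * s * (s * s - 1ℤ) * m
      lemma₁ = solve-∀
      -- Up to the factor s² m this is t (s + t) (s - 1) - (s² - 1), where s - 1 splits off and t (s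
      -- + t) - (s + 1) = (t - 1) (s + t + 1).
      lemma₂ : ∀ s t m → t * (s + t) * (s * (s - 1ℤ)) * (s * m) - s * s * (s * s - 1ℤ) * m
                       ≡ s * (s * ((s - + 1) * (t - + 1) * (s + t + + 1) * m))
      lemma₂ = solve-∀
    cancel-s² : ∀ {x y} → + s * (+ s * x) ≡ + s * (+ s * y) → x ≡ y
    cancel-s² eq = ℤ.*-cancelˡ-≡ (+ s) _ _ (ℤ.*-cancelˡ-≡ (+ s) _ _ eq)

/-cross : ∀ i j d e .{{_ : NonZero d}} .{{_ : NonZero e}} → + e * i ≡ j * + d → i / d ≡ j / e
/-cross i j (suc d) (suc e) eq =
  ℚ.fromℚᵘ-cong {mkℚᵘ i d} {mkℚᵘ j e} (*≡* (trans (ℤ.*-comm i (+ suc e)) eq))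

theorem1p1 : (s t : ℕ) → s ≥ 1 → t ≥ 1 → Coprime s t →
    Σ[ E ∈ Enumeration (IsCore s ∩ IsCore t) ]
    _/_ (+ ∑ E size) (∑ E (λ _ → 1)) {{∑1-nonZero E}}
    ≡ ((+ s - + 1) * (+ t - + 1) * (+ s + + t + + 1)) / 24
theorem1p1 s@(suc _) t s≥1 t≥1 coprime with u , t*u≡1 ← inverse s coprime =
  E , /-cross (+ ∑ E size) ((+ s - + 1) * (+ t - + 1) * (+ s + + t + + 1)) (∑ E (λ _ → 1)) 24
        {{∑1-nonZero E}} (mean-formula s t u t*u≡1 t≥1)
  where
  E = enumeration s t u t*u≡1 t≥1
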